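{- $b(5)=5^{ -5}$.
   Context: For a finite set $X$, $K_X$ is the complete graph on $X$, and a probability mass $\mu$ on $\binom{X}{2}$ is a function from the 2-element subsets of $X$ (edges of $K_X$) to $[0,1]$ with total sum $1$. For a graph $G$ and $m\geq 3$, $\mathcal C_m(G)$ is the set of (unlabeled) copies of the $m$-cycle $C_m$ in $G$. For a subgraph $G\subseteq K_X$, $\mu(G)=\prod_{e\in E(G)}\mu(e)$. Define $b(\mu;m)=\sum_{C\in\mathcal C_m(K_X)}\mu(C)$ (the probability that $m$ independent samples from $\mu$ form an $m$-cycle, up to normalization by ordering), and $b(m)=\sup\{b(\mu;m)\}$, the supremum over all finite sets $X$ and all probability masses $\mu$ on $\binom X2$.
   Formalization: The probability masses μ are taken to be rational-valued instead of real-valued; the supremum is stated as an upper bound for all such masses that is approached within every rational ε > 0. -}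

module Defs where

open import Data.Nat using (ℕ; zero; suc)
open import Data.Fin using (Fin; zero; suc; _<?_; _≟_)
open import Data.Rational using (ℚ; 0ℚ; 1ℚ; _+_; _*_; _≤_)
open import Data.Bool using (Bool; true; false; if_then_else_; _∧_; not)
open import Data.Product using (_×_)
open import Relation.Nullary.Decidable using (⌊_⌋)
open import Relation.Binary.PropositionalEquality using (_≡_)

sumFin : (n : ℕ) → (Fin n → ℚ) → ℚ
sumFin zero    f = 0ℚ
sumFin (suc n) f = f zero + sumFin n (λ i → f (suc i))

-- X = Fin n.  A weight function on edges of K_X is given as a symmetric
-- function μ : Fin n → Fin n → ℚ; only the values μ i j with i ≠ j matter
-- (the edge {i,j} has weight μ i j = μ j i).
-- Sum of μ over all edges {i,j} of K_X (each edge counted once, as i < j).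
edgeSum : (n : ℕ) → (Fin n → Fin n → ℚ) → ℚ
edgeSum n μ = sumFin n (λ i → sumFin n (λ j → if ⌊ i <? j ⌋ then μ i j else 0ℚ))

record IsProbMass (n : ℕ) (μ : Fin n → Fin n → ℚ) : Set where
  field
    symmetric : ∀ i j → μ i j ≡ μ j i
    nonneg    : ∀ i j → 0ℚ ≤ μ i j
    total     : edgeSum n μ ≡ 1ℚ

-- A 5-tuple (a,b,c,d,e) of vertices represents the 5-cycle a-b-c-d-e-a.
-- Each (unlabeled) copy of C_5 in K_X has exactly one canonical
-- representative: the five vertices are distinct, a is the least vertex,
-- and of the two neighbours of a, b is the smaller (b < e).
isCanonical5 : {n : ℕ} → Fin n → Fin n → Fin n → Fin n → Fin n → Bool
isCanonical5 a b c d e =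
  ⌊ a <? b ⌋ ∧ ⌊ a <? c ⌋ ∧ ⌊ a <? d ⌋ ∧ ⌊ a <? e ⌋ ∧ ⌊ b <? e ⌋ ∧
  not ⌊ b ≟ c ⌋ ∧ not ⌊ b ≟ d ⌋ ∧ not ⌊ c ≟ d ⌋ ∧ not ⌊ c ≟ e ⌋ ∧ not ⌊ d ≟ e ⌋

b5 : (n : ℕ) → (Fin n → Fin n → ℚ) → ℚ
b5 n μ =
  sumFin n λ a → sumFin n λ b → sumFin n λ c → sumFin n λ d → sumFin n λ e →
    if isCanonical5 a b c d e
      then μ a b * μ b c * μ c d * μ d e * μ e a
      else 0ℚ

{-# OPTIONS --safe #-}
module Submission where

-- Write P(xy) for the total weight of the 4-edge paths from x to y, so that 5 b(μ) = Σ μ(e) P(e).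
-- If P(e) > 5 b(μ) + ε for some edge e, moving a little mass to e raises b by an amount depending
-- on ε alone; b being bounded, this cannot go on forever, so it suffices to treat a μ with
-- P(e) ≤ 5 b(μ) + ε throughout. For ε = 0 these are the Lagrange conditions, and they give:
-- P(e) = 5 b on the edges of positive mass, and every vertex has degree at most 2/5, since the
-- cycles through v weigh (5/2) b deg(v) ≤ b.
--
-- Let e = xy be an edge of maximal mass M, let 2σ be the mass of the other edges at x or y, and 2h
-- the remaining mass, so that 2σ + 2h + M = 1. A path x a b c y gives P(e) ≤ σ² max_{a ≠ c} T(a, c)
-- with T(a, c) = Σ_b μ(ab) μ(bc), and T(a, c) ≤ min(h², Mh, M² + (h - M)²). Together with
-- σ + M ≤ 2/5 this forces P(e) ≤ 5⁻⁴ unless M is small, in which case P ≤ M/54 on all edges is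
-- enough. Hence b ≤ 5⁻⁵, with equality for the uniform mass on a 5-cycle.

open import Defs
open import Data.Bool using (Bool; true; false; not; _∧_; _∨_; if_then_else_)
open import Data.Empty using (⊥; ⊥-elim)
open import Data.Fin using (Fin; zero; suc; toℕ; _≟_; _<?_)
import Data.Fin as Fin
import Data.Fin.Properties as Finₚ
open import Data.Integer using (+_)
import Data.Integer as ℤ
import Data.Integer.Properties as ℤₚ
open import Data.List using (List; []; _∷_; foldr)
open import Data.List.Relation.Unary.All using (All; []; _∷_)
open import Data.List.Relation.Unary.AllPairs using (AllPairs; []; _∷_)
open import Data.Nat using (ℕ; zero; suc)
import Data.Nat as ℕ
import Data.Nat.Properties as ℕₚ
open import Data.Product using (_×_; _,_; ∃-syntax; proj₁; proj₂)
open import Data.Rational using (ℚ; mkℚ; 0ℚ; 1ℚ; ½; _/_; _+_; _*_; _-_; -_; _⊓_; _≤_; _<_; _≤?_; *<*)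
open import Data.Rational using (positive; nonNegative; toℚᵘ)
import Data.Rational as ℚ
open import Data.Rational.Properties hiding (_≟_; _<?_) renaming (nonNegative⁻¹ to 0≤const)
open import Data.Rational.Unnormalised using (mkℚᵘ; *≡*; *≤*)
import Data.Rational.Unnormalised as ℚᵘ
import Data.Rational.Unnormalised.Properties as ℚᵘₚ
open import Data.Sum using (_⊎_; inj₁; inj₂; [_,_]′)
open import Level using (0ℓ)
open import Relation.Binary.Definitions using (tri<; tri≈; tri>)
open import Relation.Binary.PropositionalEquality
open import Relation.Nullary using (¬_; Dec; yes; no; does)
open import Relation.Nullary.Decidable using (⌊_⌋; _×-dec_; ¬?; dec⇒maybe; dec-true; dec-false; from-yes)
open import Tactic.RingSolver using (solve-∀)
open import Tactic.RingSolver.Core.AlmostCommutativeRing using (AlmostCommutativeRing; fromCommutativeRing)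

private variable
  n : ℕ

-- Ordered field arithmetic

ℚ-ring : AlmostCommutativeRing 0ℓ 0ℓ
ℚ-ring = fromCommutativeRing +-*-commutativeRing (λ x → dec⇒maybe (0ℚ ℚ.≟ x))

0≤+ : ∀ {p q} → 0ℚ ≤ p → 0ℚ ≤ q → 0ℚ ≤ p + q
0≤+ {p} {q} 0≤p 0≤q = +-mono-≤ 0≤p 0≤q

0≤* : ∀ {p q} → 0ℚ ≤ p → 0ℚ ≤ q → 0ℚ ≤ p * q
0≤* {p} {q} 0≤p 0≤q =
  subst (_≤ p * q) (*-zeroʳ p) (*-monoˡ-≤-nonNeg p {{nonNegative 0≤p}} 0≤q)

*-mono-≤ : ∀ {p q r s} → 0ℚ ≤ q → 0ℚ ≤ r → p ≤ q → r ≤ s → p * r ≤ q * s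
*-mono-≤ {p} {q} {r} {s} 0≤q 0≤r p≤q r≤s =
  ≤-trans (*-monoʳ-≤-nonNeg r {{nonNegative 0≤r}} p≤q)
          (*-monoˡ-≤-nonNeg q {{nonNegative 0≤q}} r≤s)

*-monoˡ-≤ : ∀ {r p q} → 0ℚ ≤ r → p ≤ q → r * p ≤ r * q
*-monoˡ-≤ {r} 0≤r = *-monoˡ-≤-nonNeg r {{nonNegative 0≤r}}

*-cancel : ∀ {r p q} → 0ℚ < r → r * p ≤ r * q → p ≤ q
*-cancel {r} 0<r = *-cancelˡ-≤-pos r {{positive 0<r}}

p≤q⇒0≤q-p : ∀ {p q} → p ≤ q → 0ℚ ≤ q - p
p≤q⇒0≤q-p {p} {q} p≤q = subst (_≤ q - p) (+-inverseʳ p) (+-monoˡ-≤ (- p) p≤q)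

-- Most polynomial inequalities below go through this lemma: the gap q - p is rewritten as a visibly
-- nonnegative expression and the ring solver checks the identity.
by-gap : ∀ {p q s} → 0ℚ ≤ s → q - p ≡ s → p ≤ q
by-gap {p} {q} 0≤s eq = subst₂ _≤_ (+-identityˡ p) (add-back q p)
  (+-monoˡ-≤ p (subst (0ℚ ≤_) (sym eq) 0≤s))
  where
  add-back : ∀ q p → q - p + p ≡ q
  add-back = solve-∀ ℚ-ring

p≤p+q : ∀ p {q} → 0ℚ ≤ q → p ≤ p + q
p≤p+q p {q} 0≤q = subst (_≤ p + q) (+-identityʳ p) (+-monoʳ-≤ p 0≤q)

p≤q+p : ∀ p {q} → 0ℚ ≤ q → p ≤ q + p
p≤q+p p {q} 0≤q = subst (_≤ q + p) (+-identityˡ p) (+-monoˡ-≤ p 0≤q)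

0≤square : ∀ p → 0ℚ ≤ p * p
0≤square p with ≤-total 0ℚ p
... | inj₁ 0≤p = 0≤* 0≤p 0≤p
... | inj₂ p≤0 = subst (0ℚ ≤_) (square-neg p) (0≤* (p≤q⇒0≤q-p p≤0) (p≤q⇒0≤q-p p≤0))
  where
  square-neg : ∀ p → (0ℚ - p) * (0ℚ - p) ≡ p * p
  square-neg = solve-∀ ℚ-ring

0<* : ∀ {p q} → 0ℚ < p → 0ℚ < q → 0ℚ < p * q
0<* {p} {q} 0<p 0<q = subst (_< p * q) (*-zeroʳ p) (*-monoʳ-<-pos p {{positive 0<p}} 0<q)

-- 4(z² - xy) = ((2z)² - (x + y)²) + (x - y)².
am-gm : ∀ {x y} z → 0ℚ ≤ x → 0ℚ ≤ y → x + y ≤ z + z → x * y ≤ z * z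
am-gm {x} {y} z 0≤x 0≤y x+y≤2z = by-gap
  (0≤* (0≤const (+ 1 / 4))
       (0≤+ (0≤* (p≤q⇒0≤q-p x+y≤2z) (0≤+ 0≤2z 0≤x+y)) (0≤square (x - y))))
  (identity x y z)
  where
  0≤x+y : 0ℚ ≤ x + y
  0≤x+y = 0≤+ 0≤x 0≤y
  0≤2z : 0ℚ ≤ z + z
  0≤2z = ≤-trans 0≤x+y x+y≤2z
  identity : ∀ x y z →
    z * z - x * y ≡ + 1 / 4 * ((z + z - (x + y)) * (z + z + (x + y)) + (x - y) * (x - y))
  identity = solve-∀ ℚ-ring

square-mono : ∀ {p q} → 0ℚ ≤ p → p ≤ q → p * p ≤ q * q
square-mono 0≤p p≤q = *-mono-≤ (≤-trans 0≤p p≤q) 0≤p p≤q p≤q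

-- The polynomial inequality behind the bound on P

module KeyInequality
  {κ σ M h t : ℚ}
  -- All conditions are homogeneous in the scale κ, which is 1/5 in the exact case and slightly
  -- larger under approximate criticality. For κ = 1/5 they read M ≥ 2/25, average degree of x and y
  -- at most 2/5, and total mass at most 1.
  (0<κ : 0ℚ < κ) (0≤σ : 0ℚ ≤ σ) (0≤M : 0ℚ ≤ M) (0≤h : 0ℚ ≤ h) (0≤t : 0ℚ ≤ t)
  (2κ≤5M : + 2 / 1 * κ ≤ + 5 / 1 * M)
  (σ+M≤2κ : σ + M ≤ κ + κ)
  (budget : σ + σ + (h + h) + M ≤ + 5 / 1 * κ)
  (t≤h² : t ≤ h * h) (t≤Mh : t ≤ M * h)
  (t≤two-blocks : M ≤ h → t ≤ M * M + (h - M) * (h - M))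
  where

  private
    0≤κ : 0ℚ ≤ κ
    0≤κ = <⇒≤ 0<κ

    -- By t ≤ h² the product is at most (σh)², and AM-GM gives σh ≤ κ².
    small-sum : σ + h ≤ κ + κ → σ * σ * t ≤ κ * κ * (κ * κ)
    small-sum σ+h≤2κ = ≤-trans (*-monoˡ-≤ (0≤square σ) t≤h²)
      (subst (_≤ κ * κ * (κ * κ)) (regroup σ h)
        (square-mono (0≤* 0≤σ 0≤h) (am-gm κ 0≤σ 0≤h σ+h≤2κ)))
      where
      regroup : ∀ σ h → σ * h * (σ * h) ≡ σ * σ * (h * h)
      regroup = solve-∀ ℚ-ring

    -- The budget gives σ ≤ τ = a - x. In the identity the last summand, κ(κ - M)²(4κ - M)/4, is the
    -- gap at h = κ, and the first one is M times the decrease of τ²h as h grows beyond κ.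
    large-h : M ≤ κ → κ ≤ h → σ * σ * t ≤ κ * κ * (κ * κ)
    large-h M≤κ κ≤h = ≤-trans
      (*-mono-≤ (0≤square τ) 0≤t (square-mono 0≤σ σ≤τ) t≤Mh)
      (by-gap
        (0≤+ (0≤* 0≤M (0≤+ (0≤* (0≤* 0≤a (0≤* (0≤const ½) (0≤+ 0≤κ 0≤M))) 0≤x)
                          (0≤* (0≤square x) (0≤+ 0≤τ (0≤* (0≤const ½) 0≤κ-M)))))
             (0≤* (0≤* (0≤const (+ 1 / 4)) 0≤κ)
                  (0≤* (0≤square (κ - M)) (0≤+ 0≤κ-M (0≤* (0≤const (+ 3 / 1)) 0≤κ)))))
        (identity κ M h))
      where
      a x τ : ℚ
      a = ½ * (+ 3 / 1 * κ - M)
      x = h - κ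
      τ = ½ * (+ 3 / 1 * κ - M) - (h - κ)
      0≤x : 0ℚ ≤ x
      0≤x = p≤q⇒0≤q-p κ≤h
      0≤κ-M : 0ℚ ≤ κ - M
      0≤κ-M = p≤q⇒0≤q-p M≤κ
      σ≤τ : σ ≤ τ
      σ≤τ = by-gap (0≤* (0≤const ½) (p≤q⇒0≤q-p budget)) (eq κ M h σ)
        where
        eq : ∀ κ M h σ → ½ * (+ 3 / 1 * κ - M) - (h - κ) - σ
             ≡ ½ * (+ 5 / 1 * κ - (σ + σ + (h + h) + M))
        eq = solve-∀ ℚ-ring
      0≤τ : 0ℚ ≤ τ
      0≤τ = ≤-trans 0≤σ σ≤τ
      0≤a : 0ℚ ≤ a
      0≤a = subst (0ℚ ≤_) (eq a x) (0≤+ 0≤τ 0≤x)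
        where
        eq : ∀ a x → a - x + x ≡ a
        eq = solve-∀ ℚ-ring
      identity : ∀ κ M h → let a = ½ * (+ 3 / 1 * κ - M); x = h - κ in
        κ * κ * (κ * κ) - (a - x) * (a - x) * (M * h)
        ≡ M * (a * (½ * (κ + M)) * x + x * x * (a - x + ½ * (κ - M)))
          + + 1 / 4 * κ * ((κ - M) * (κ - M) * (κ - M + + 3 / 1 * κ))
      identity = solve-∀ ℚ-ring

    -- Weighted AM-GM: with λ = l = 2κ − M the weights κ² and λ² make κ²σ² + λ²(M² + s²) = 2λκ³ at the
    -- critical configuration σ = M = κ, s = 0.
    middle-h : M ≤ h → h ≤ κ → σ * σ * t ≤ κ * κ * (κ * κ)
    middle-h M≤h h≤κ = ≤-trans (*-monoˡ-≤ (0≤square σ) (t≤two-blocks M≤h))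
      (*-cancel (<-≤-trans 0<κ⁴ κ⁴≤κ²λ²)
        (subst₂ _≤_ (eq₁ κ l σ (M * M + s * s)) (eq₂ κ l)
          (am-gm (l * (κ * κ * κ)) (0≤* (0≤square κ) (0≤square σ))
                 (0≤* (0≤square l) (0≤+ (0≤square M) (0≤square s)))
                 sum≤)))
      where
      R l s : ℚ
      R = κ - M
      l = κ + R
      s = h - M
      0≤R : 0ℚ ≤ R
      0≤R = p≤q⇒0≤q-p (≤-trans M≤h h≤κ)
      0≤s : 0ℚ ≤ s
      0≤s = p≤q⇒0≤q-p M≤h
      0≤l : 0ℚ ≤ l
      0≤l = 0≤+ 0≤κ 0≤R
      0≤3κ-5R : 0ℚ ≤ + 3 / 1 * κ - + 5 / 1 * R
      0≤3κ-5R = subst (0ℚ ≤_) (eq κ M) (p≤q⇒0≤q-p 2κ≤5M)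
        where
        eq : ∀ κ M → + 5 / 1 * M - + 2 / 1 * κ ≡ + 3 / 1 * κ - + 5 / 1 * (κ - M)
        eq = solve-∀ ℚ-ring
      0<κ⁴ : 0ℚ < κ * κ * (κ * κ)
      0<κ⁴ = 0<* (0<* 0<κ 0<κ) (0<* 0<κ 0<κ)
      κ≤l : κ ≤ l
      κ≤l = by-gap 0≤R (eq κ R)
        where
        eq : ∀ κ R → κ + R - κ ≡ R
        eq = solve-∀ ℚ-ring
      κ⁴≤κ²λ² : κ * κ * (κ * κ) ≤ κ * κ * (l * l)
      κ⁴≤κ²λ² = *-monoˡ-≤ (0≤square κ) (square-mono 0≤κ κ≤l)
      σ≤l : σ ≤ l
      σ≤l = by-gap (p≤q⇒0≤q-p σ+M≤2κ) (eq κ M σ)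
        where
        eq : ∀ κ M σ → κ + (κ - M) - σ ≡ κ + κ - (σ + M)
        eq = solve-∀ ℚ-ring
      0≤core : 0ℚ ≤ l * (R * R * (+ 1 / 4 * (+ 3 / 1 * κ - + 5 / 1 * R)))
      0≤core = 0≤* 0≤l (0≤* (0≤square R) (0≤* (0≤const (+ 1 / 4)) 0≤3κ-5R))

      -- At s = R/2 the degree condition σ + M ≤ 2κ and the budget both say σ ≤ l, so this is where
      -- the cases divide. Below it the degree condition is the sharper one, and the gap at σ = l, s
      -- = R/2 is lR²(3κ - 5R)/4, nonnegative because 2κ ≤ 5M.
      short : s ≤ ½ * R →
        κ * κ * (σ * σ) + l * l * (M * M + s * s) ≤ l * (κ * κ * κ) + l * (κ * κ * κ)
      short s≤R/2 = by-gap
        (0≤+ (0≤+ (0≤* (0≤square κ) (p≤q⇒0≤q-p (square-mono 0≤σ σ≤l)))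
                  (0≤* (0≤square l) (p≤q⇒0≤q-p (square-mono 0≤s s≤R/2))))
             0≤core)
        (eq κ M s σ)
        where
        eq : ∀ κ M s σ → let R = κ - M; l = κ + (κ - M) in
          l * (κ * κ * κ) + l * (κ * κ * κ) - (κ * κ * (σ * σ) + l * l * (M * M + s * s))
          ≡ κ * κ * (l * l - σ * σ) + l * l * (½ * R * (½ * R) - s * s)
            + l * (R * R * (+ 1 / 4 * (+ 3 / 1 * κ - + 5 / 1 * R)))
        eq = solve-∀ ℚ-ring

      -- Now the budget is sharper: σ ≤ l - y. At σ = l - y the gap exceeds its value for y = 0 by y
      -- times a factor that decreases in y; `slope` is that factor at h = κ, the far end of the
      -- range.
      long : ½ * R ≤ s →
        κ * κ * (σ * σ) + l * l * (M * M + s * s) ≤ l * (κ * κ * κ) + l * (κ * κ * κ)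
      long R/2≤s = by-gap
        (0≤+ (0≤+ (0≤* (0≤square κ) (p≤q⇒0≤q-p (square-mono 0≤σ σ≤l-y)))
                  (0≤* 0≤y (0≤+ 0≤slope
                    (0≤* (0≤+ (0≤square κ) (0≤square l)) 0≤κ-h))))
             0≤core)
        (eq κ M h σ)
        where
        y : ℚ
        y = s - ½ * R
        0≤y : 0ℚ ≤ y
        0≤y = p≤q⇒0≤q-p R/2≤s
        0≤κ-h : 0ℚ ≤ κ - h
        0≤κ-h = p≤q⇒0≤q-p h≤κ
        σ≤l-y : σ ≤ l - y
        σ≤l-y = by-gap (0≤* (0≤const ½) (p≤q⇒0≤q-p budget)) (eq′ κ M h σ)
          where
          eq′ : ∀ κ M h σ → κ + (κ - M) - (h - M - ½ * (κ - M)) - σ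
            ≡ ½ * (+ 5 / 1 * κ - (σ + σ + (h + h) + M))
          eq′ = solve-∀ ℚ-ring
        slope : ℚ
        slope = κ * κ * (+ 2 / 1 * l - ½ * R) - + 3 / 2 * R * (l * l)
        -- Expanded, `slope` is 2κ³ - 3κR² - (3/2)R³, which decreases in R. At R = 3κ/5, the largest
        -- value that 2κ ≤ 5M permits, it equals (149/250)κ³.
        0≤slope : 0ℚ ≤ slope
        0≤slope = subst (0ℚ ≤_) (sym (eq′ κ R))
          (0≤+ (0≤* (0≤const (+ 149 / 250)) (0≤* (0≤square κ) 0≤κ))
               (0≤* (0≤* (0≤const (+ 1 / 5)) 0≤3κ-5R)
                    (0≤+ (0≤* (0≤const (+ 3 / 1)) (0≤* 0≤κ (0≤+ 0≤R 0≤cκ)))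
                         (0≤* (0≤const (+ 3 / 2))
                              (0≤+ (0≤+ (0≤square R) (0≤* 0≤cκ 0≤R)) (0≤square (+ 3 / 5 * κ)))))))
          where
          0≤cκ : 0ℚ ≤ + 3 / 5 * κ
          0≤cκ = 0≤* (0≤const (+ 3 / 5)) 0≤κ
          eq′ : ∀ κ R → let l = κ + R; c = + 3 / 5 * κ in
            κ * κ * (+ 2 / 1 * l - ½ * R) - + 3 / 2 * R * (l * l)
            ≡ + 149 / 250 * (κ * κ * κ)
              + + 1 / 5 * (+ 3 / 1 * κ - + 5 / 1 * R)
                * (+ 3 / 1 * (κ * (R + c)) + + 3 / 2 * (R * R + c * R + c * c))
          eq′ = solve-∀ ℚ-ring
        eq : ∀ κ M h σ → let R = κ - M; l = κ + (κ - M); s = h - M; y = s - ½ * R in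
          l * (κ * κ * κ) + l * (κ * κ * κ) - (κ * κ * (σ * σ) + l * l * (M * M + s * s))
          ≡ κ * κ * ((l - y) * (l - y) - σ * σ)
            + y * (κ * κ * (+ 2 / 1 * l - ½ * R) - + 3 / 2 * R * (l * l)
                   + (κ * κ + l * l) * (κ - h))
            + l * (R * R * (+ 1 / 4 * (+ 3 / 1 * κ - + 5 / 1 * R)))
        eq = solve-∀ ℚ-ring

      sum≤ : κ * κ * (σ * σ) + l * l * (M * M + s * s) ≤ l * (κ * κ * κ) + l * (κ * κ * κ)
      sum≤ with ≤-total s (½ * R)
      ... | inj₁ s≤R/2 = short s≤R/2
      ... | inj₂ R/2≤s = long R/2≤s

      eq₁ : ∀ κ l σ t → κ * κ * (σ * σ) * (l * l * t) ≡ κ * κ * (l * l) * (σ * σ * t)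
      eq₁ = solve-∀ ℚ-ring
      eq₂ : ∀ κ l → l * (κ * κ * κ) * (l * (κ * κ * κ)) ≡ κ * κ * (l * l) * (κ * κ * (κ * κ))
      eq₂ = solve-∀ ℚ-ring

  -- If M ≥ κ the budget forces σ + h ≤ 2κ, and if h ≤ M the degree condition does. What remains is
  -- M ≤ κ and M ≤ h, where the position of h relative to κ decides which bound on t is efficient.
  key-inequality : σ * σ * t ≤ κ * κ * (κ * κ)
  key-inequality with ≤-total (σ + h) (κ + κ) | ≤-total M κ | ≤-total M h | ≤-total h κ
  ... | inj₁ σ+h≤2κ | _ | _ | _ = small-sum σ+h≤2κ
  ... | inj₂ _ | inj₂ κ≤M | _ | _ = small-sum (by-gap
        (0≤* (0≤const ½) (0≤+ (p≤q⇒0≤q-p budget) (p≤q⇒0≤q-p κ≤M))) (eq κ σ h M))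
    where
    eq : ∀ κ σ h M → κ + κ - (σ + h)
       ≡ ½ * (+ 5 / 1 * κ - (σ + σ + (h + h) + M) + (M - κ))
    eq = solve-∀ ℚ-ring
  ... | inj₂ _ | inj₁ _ | inj₂ h≤M | _ = small-sum (≤-trans (+-monoʳ-≤ σ h≤M) σ+M≤2κ)
  ... | inj₂ _ | inj₁ M≤κ | inj₁ _ | inj₂ κ≤h = large-h M≤κ κ≤h
  ... | inj₂ _ | inj₁ _ | inj₁ M≤h | inj₁ h≤κ = middle-h M≤h h≤κ

-- Finite sums

∑ : (Fin n → ℚ) → ℚ
∑ {n} = sumFin n

∑-cong : {f g : Fin n → ℚ} → (∀ i → f i ≡ g i) → ∑ f ≡ ∑ g
∑-cong {zero}  f≡g = refl
∑-cong {suc n} f≡g = cong₂ _+_ (f≡g zero) (∑-cong (λ i → f≡g (suc i)))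

∑-mono : {f g : Fin n → ℚ} → (∀ i → f i ≤ g i) → ∑ f ≤ ∑ g
∑-mono {zero}  f≤g = ≤-refl
∑-mono {suc n} f≤g = +-mono-≤ (f≤g zero) (∑-mono (λ i → f≤g (suc i)))

∑-0 : ∀ n → ∑ {n} (λ _ → 0ℚ) ≡ 0ℚ
∑-0 zero    = refl
∑-0 (suc n) = trans (+-identityˡ _) (∑-0 n)

∑-+ : (f g : Fin n → ℚ) → ∑ (λ i → f i + g i) ≡ ∑ f + ∑ g
∑-+ {zero}  f g = refl
∑-+ {suc n} f g = trans (cong (λ z → f zero + g zero + z) (∑-+ (λ i → f (suc i)) (λ i → g (suc i))))
  (interchange (f zero) (g zero) (∑ λ i → f (suc i)) (∑ λ i → g (suc i)))
  where
  interchange : ∀ a b c d → a + b + (c + d) ≡ a + c + (b + d)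
  interchange = solve-∀ ℚ-ring

∑-- : (f g : Fin n → ℚ) → ∑ (λ i → f i - g i) ≡ ∑ f - ∑ g
∑-- {zero}  f g = refl
∑-- {suc n} f g = trans (cong (λ z → f zero - g zero + z) (∑-- (λ i → f (suc i)) (λ i → g (suc i))))
  (interchange (f zero) (g zero) (∑ λ i → f (suc i)) (∑ λ i → g (suc i)))
  where
  interchange : ∀ a b c d → a - b + (c - d) ≡ a + c - (b + d)
  interchange = solve-∀ ℚ-ring

*-∑ : ∀ c (f : Fin n → ℚ) → c * ∑ f ≡ ∑ (λ i → c * f i)
*-∑ {zero}  c f = *-zeroʳ c
*-∑ {suc n} c f = trans (*-distribˡ-+ c _ _) (cong (λ z → c * f zero + z) (*-∑ c (λ i → f (suc i))))

∑-* : ∀ (f : Fin n → ℚ) c → ∑ f * c ≡ ∑ (λ i → f i * c)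
∑-* f c = trans (*-comm (∑ f) c) (trans (*-∑ c f) (∑-cong (λ i → *-comm c (f i))))

∑-swap : ∀ {m} (f : Fin m → Fin n → ℚ) → ∑ (λ i → ∑ (f i)) ≡ ∑ (λ j → ∑ (λ i → f i j))
∑-swap {n} {zero}  f = sym (∑-0 n)
∑-swap {n} {suc m} f = trans (cong (λ z → ∑ (f zero) + z) (∑-swap (λ i → f (suc i))))
  (sym (∑-+ (f zero) (λ j → ∑ (λ i → f (suc i) j))))

0≤∑ : {f : Fin n → ℚ} → (∀ i → 0ℚ ≤ f i) → 0ℚ ≤ ∑ f
0≤∑ {n} {f} 0≤f = subst (_≤ ∑ f) (∑-0 n) (∑-mono 0≤f)

term≤∑ : {f : Fin n → ℚ} → (∀ i → 0ℚ ≤ f i) → ∀ i → f i ≤ ∑ f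
term≤∑ {f = f} 0≤f zero = p≤p+q (f zero) (0≤∑ (λ i → 0≤f (suc i)))
term≤∑ {f = f} 0≤f (suc i) = ≤-trans (term≤∑ (λ i → 0≤f (suc i)) i) (p≤q+p _ (0≤f zero))

-- Indicators of equality

⟦_⟧ : Bool → ℚ
⟦ b ⟧ = if b then 1ℚ else 0ℚ

δ N : Fin n → Fin n → ℚ
δ i j = ⟦ does (i ≟ j) ⟧
N i j = ⟦ not (does (i ≟ j)) ⟧

0≤⟦⟧ : ∀ b → 0ℚ ≤ ⟦ b ⟧
0≤⟦⟧ true  = 0≤const 1ℚ
0≤⟦⟧ false = ≤-refl

⟦⟧≤1 : ∀ b → ⟦ b ⟧ ≤ 1ℚ
⟦⟧≤1 true  = ≤-refl
⟦⟧≤1 false = 0≤const 1ℚ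

⟦⟧-idem : ∀ b → ⟦ b ⟧ * ⟦ b ⟧ ≡ ⟦ b ⟧
⟦⟧-idem true  = refl
⟦⟧-idem false = refl

⟦⟧-not : ∀ b → ⟦ not b ⟧ + ⟦ b ⟧ ≡ 1ℚ
⟦⟧-not true  = refl
⟦⟧-not false = refl

0≤N : ∀ (i j : Fin n) → 0ℚ ≤ N i j
0≤N i j = 0≤⟦⟧ (not (does (i ≟ j)))

N≤1 : ∀ (i j : Fin n) → N i j ≤ 1ℚ
N≤1 i j = ⟦⟧≤1 (not (does (i ≟ j)))

N-refl : ∀ (i : Fin n) → N i i ≡ 0ℚ
N-refl i = cong (λ b → ⟦ not b ⟧) (dec-true (i ≟ i) refl)

N-≢ : ∀ {i j : Fin n} → i ≢ j → N i j ≡ 1ℚ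
N-≢ {i = i} {j} i≢j = cong (λ b → ⟦ not b ⟧) (dec-false (i ≟ j) i≢j)

does-sym : ∀ (i j : Fin n) → does (i ≟ j) ≡ does (j ≟ i)
does-sym i j with i ≟ j
... | yes refl = sym (dec-true (i ≟ i) refl)
... | no  i≢j  = sym (dec-false (j ≟ i) (λ j≡i → i≢j (sym j≡i)))

N-sym : ∀ (i j : Fin n) → N i j ≡ N j i
N-sym i j = cong (λ b → ⟦ not b ⟧) (does-sym i j)

∑-δ : ∀ (i : Fin n) f → ∑ (λ j → δ i j * f j) ≡ f i
∑-δ {suc n} zero f = trans
  (cong₂ _+_ (*-identityˡ (f zero)) (trans (∑-cong (λ j → *-zeroˡ (f (suc j)))) (∑-0 n)))
  (+-identityʳ (f zero))
∑-δ {suc n} (suc i) f =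
  trans (cong₂ _+_ (*-zeroˡ (f zero)) (∑-δ i (λ j → f (suc j)))) (+-identityˡ (f (suc i)))

argmax : (f : Fin (suc n) → ℚ) → ∃[ i ] (∀ j → f j ≤ f i)
argmax {zero}  f = zero , λ { zero → ≤-refl }
argmax {suc n} f with argmax (λ i → f (suc i))
... | i , f≤fi with ≤-total (f zero) (f (suc i))
... | inj₁ f0≤fi = suc i , λ { zero → f0≤fi ; (suc j) → f≤fi j }
... | inj₂ fi≤f0 = zero , λ { zero → ≤-refl ; (suc j) → ≤-trans (f≤fi j) fi≤f0 }

argmax₂ : (f : Fin (suc n) → Fin (suc n) → ℚ) → ∃[ i ] ∃[ j ] (∀ k l → f k l ≤ f i j)
argmax₂ f with argmax (λ i → f i (proj₁ (argmax (f i))))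
... | i , max = i , proj₁ (argmax (f i)) , λ k l → ≤-trans (proj₂ (argmax (f k)) l) (max k)

-- Sums of squares

∑²≤² : {p : Fin n → ℚ} → (∀ i → 0ℚ ≤ p i) → ∑ (λ i → p i * p i) ≤ ∑ p * ∑ p
∑²≤² {p = p} 0≤p = ≤-trans (∑-mono (λ i → *-monoˡ-≤ (0≤p i) (term≤∑ 0≤p i)))
  (≤-reflexive (sym (∑-* p (∑ p))))

∑²≤max*∑ : ∀ {M} {p : Fin n → ℚ} → (∀ i → 0ℚ ≤ p i) → (∀ i → p i ≤ M) →
  ∑ (λ i → p i * p i) ≤ M * ∑ p
∑²≤max*∑ {M = M} {p} 0≤p p≤M = ≤-trans
  (∑-mono (λ i → *-monoʳ-≤-nonNeg (p i) {{nonNegative (0≤p i)}} (p≤M i)))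
  (≤-reflexive (sym (*-∑ M p)))

-- For M ≤ ∑ p the right-hand side is the value at two blocks M and ∑ p - M, the extreme
-- point of the convex left-hand side when M ≤ ∑ p ≤ 2M.
∑²≤two-blocks : ∀ {M} {p : Fin n → ℚ} → (∀ i → 0ℚ ≤ p i) → (∀ i → p i ≤ M) →
  ∑ (λ i → p i * p i) ≤ M * M + (∑ p - M) * (∑ p - M)
∑²≤two-blocks {zero} {M} _ _ = 0≤+ (0≤square M) (0≤square (0ℚ - M))
∑²≤two-blocks {suc n} {M} {p} 0≤p p≤M with ≤-total (∑ (λ i → p (suc i))) M
-- Entries are peeled off until the rest s is at most M. There x² + s² falls short of the bound by
-- 2(M - s)(M - x); at the earlier entries, where s ≥ M, x² + (s - M)² ≤ (x + s - M)².
... | inj₁ s≤M = ≤-trans (+-monoʳ-≤ (p zero * p zero) (∑²≤² (λ i → 0≤p (suc i))))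
  (by-gap (0≤* (0≤const (1ℚ + 1ℚ)) (0≤* (p≤q⇒0≤q-p s≤M) (p≤q⇒0≤q-p (p≤M zero))))
          (eq M (p zero) (∑ (λ i → p (suc i)))))
  where
  eq : ∀ M x s → M * M + (x + s - M) * (x + s - M) - (x * x + s * s) ≡ (1ℚ + 1ℚ) * ((M - s) * (M - x))
  eq = solve-∀ ℚ-ring
... | inj₂ M≤s = ≤-trans
  (+-monoʳ-≤ (p zero * p zero) (∑²≤two-blocks (λ i → 0≤p (suc i)) (λ i → p≤M (suc i))))
  (by-gap (0≤* (0≤const (1ℚ + 1ℚ)) (0≤* (0≤p zero) (p≤q⇒0≤q-p M≤s)))
          (eq M (p zero) (∑ (λ i → p (suc i)))))
  where
  eq : ∀ M x s → M * M + (x + s - M) * (x + s - M) - (x * x + (M * M + (s - M) * (s - M)))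
       ≡ (1ℚ + 1ℚ) * (x * (s - M))
  eq = solve-∀ ℚ-ring

-- Reordering iterated sums

∑-inward₃ : (f : Fin n → Fin n → Fin n → ℚ) →
  ∑ (λ a → ∑ λ b → ∑ λ c → f a b c) ≡ ∑ (λ b → ∑ λ c → ∑ λ a → f a b c)
∑-inward₃ f = trans (∑-swap (λ a b → ∑ (f a b))) (∑-cong (λ b → ∑-swap (λ a c → f a b c)))

∑-inward₄ : (f : Fin n → Fin n → Fin n → Fin n → ℚ) →
  ∑ (λ a → ∑ λ b → ∑ λ c → ∑ λ d → f a b c d) ≡ ∑ (λ b → ∑ λ c → ∑ λ d → ∑ λ a → f a b c d)
∑-inward₄ f = trans (∑-swap (λ a b → ∑ λ c → ∑ (f a b c)))
  (∑-cong (λ b → ∑-inward₃ (λ a c d → f a b c d)))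

∑₅ : (Fin n → Fin n → Fin n → Fin n → Fin n → ℚ) → ℚ
∑₅ f = ∑ λ a → ∑ λ b → ∑ λ c → ∑ λ d → ∑ λ e → f a b c d e

∑-inward₅ : (f : Fin n → Fin n → Fin n → Fin n → Fin n → ℚ) →
  ∑₅ f ≡ ∑ (λ b → ∑ λ c → ∑ λ d → ∑ λ e → ∑ λ a → f a b c d e)
∑-inward₅ f = trans (∑-swap (λ a b → ∑ λ c → ∑ λ d → ∑ (f a b c d)))
  (∑-cong (λ b → ∑-inward₄ (λ a c d e → f a b c d e)))

∑₅-cong : {f g : Fin n → Fin n → Fin n → Fin n → Fin n → ℚ} →
  (∀ a b c d e → f a b c d e ≡ g a b c d e) → ∑₅ f ≡ ∑₅ g
∑₅-cong f≡g = ∑-cong λ a → ∑-cong λ b → ∑-cong λ c → ∑-cong λ d → ∑-cong λ e → f≡g a b c d e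

∑₅-mono : {f g : Fin n → Fin n → Fin n → Fin n → Fin n → ℚ} →
  (∀ a b c d e → f a b c d e ≤ g a b c d e) → ∑₅ f ≤ ∑₅ g
∑₅-mono f≤g = ∑-mono λ a → ∑-mono λ b → ∑-mono λ c → ∑-mono λ d → ∑-mono λ e → f≤g a b c d e

∑₅-+ : (f g : Fin n → Fin n → Fin n → Fin n → Fin n → ℚ) →
  ∑₅ (λ a b c d e → f a b c d e + g a b c d e) ≡ ∑₅ f + ∑₅ g
∑₅-+ f g = trans (∑-cong λ a → trans (∑-cong λ b → trans (∑-cong λ c → trans (∑-cong λ d →
  ∑-+ (f a b c d) (g a b c d))
  (∑-+ (λ d → ∑ (f a b c d)) (λ d → ∑ (g a b c d))))
  (∑-+ (λ c → ∑ λ d → ∑ (f a b c d)) (λ c → ∑ λ d → ∑ (g a b c d))))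
  (∑-+ (λ b → ∑ λ c → ∑ λ d → ∑ (f a b c d)) (λ b → ∑ λ c → ∑ λ d → ∑ (g a b c d))))
  (∑-+ (λ a → ∑ λ b → ∑ λ c → ∑ λ d → ∑ (f a b c d)) (λ a → ∑ λ b → ∑ λ c → ∑ λ d → ∑ (g a b c d)))

*-∑₃ : ∀ k (f : Fin n → Fin n → Fin n → ℚ) →
  k * ∑ (λ a → ∑ λ b → ∑ λ c → f a b c) ≡ ∑ (λ a → ∑ λ b → ∑ λ c → k * f a b c)
*-∑₃ k f = trans (*-∑ k (λ a → ∑ λ b → ∑ (f a b)))
  (∑-cong λ a → trans (*-∑ k (λ b → ∑ (f a b))) (∑-cong λ b → *-∑ k (f a b)))

*-∑₅ : ∀ k (f : Fin n → Fin n → Fin n → Fin n → Fin n → ℚ) →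
  k * ∑₅ f ≡ ∑₅ (λ a b c d e → k * f a b c d e)
*-∑₅ k f = trans (*-∑ k (λ a → ∑ λ b → ∑ λ c → ∑ λ d → ∑ (f a b c d)))
  (∑-cong λ a → trans (*-∑ k (λ b → ∑ λ c → ∑ λ d → ∑ (f a b c d)))
  (∑-cong λ b → *-∑₃ k (f a b)))

∑₅-rotate : (f : Fin n → Fin n → Fin n → Fin n → Fin n → ℚ) →
  ∑₅ (λ a b c d e → f b c d e a) ≡ ∑₅ f
∑₅-rotate f = ∑-inward₅ (λ a b c d e → f b c d e a)

∑₅-reflect : (f : Fin n → Fin n → Fin n → Fin n → Fin n → ℚ) →
  ∑₅ (λ a b c d e → f a e d c b) ≡ ∑₅ f
∑₅-reflect f = ∑-cong λ a → trans (∑-inward₄ (λ b c d e → f a e d c b))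
  (trans (∑-inward₃ (λ c d e → ∑ λ b → f a e d c b))
         (∑-swap (λ d e → ∑ λ c → ∑ λ b → f a e d c b)))

∑₅-rotations : (f : Fin n → Fin n → Fin n → Fin n → Fin n → ℚ) →
  ∑₅ (λ a b c d e → f a b c d e + (f b c d e a + (f c d e a b + (f d e a b c + f e a b c d))))
  ≡ + 5 / 1 * ∑₅ f
∑₅-rotations {n} f =
  trans (∑₅-+ f (λ a b c d e → f₁ a b c d e + (f₂ a b c d e + (f₃ a b c d e + f₄ a b c d e))))
    (trans (cong (λ s → ∑₅ f + s)
  (trans (∑₅-+ f₁ (λ a b c d e → f₂ a b c d e + (f₃ a b c d e + f₄ a b c d e))) (cong₂ _+_ S₁
  (trans (∑₅-+ f₂ (λ a b c d e → f₃ a b c d e + f₄ a b c d e)) (cong₂ _+_ S₂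
  (trans (∑₅-+ f₃ f₄) (cong₂ _+_ S₃ S₄))))))) (five (∑₅ f)))
  where
  f₁ f₂ f₃ f₄ : Fin n → Fin n → Fin n → Fin n → Fin n → ℚ
  f₁ a b c d e = f b c d e a
  f₂ a b c d e = f c d e a b
  f₃ a b c d e = f d e a b c
  f₄ a b c d e = f e a b c d
  S₁ : ∑₅ f₁ ≡ ∑₅ f
  S₁ = ∑₅-rotate f
  S₂ : ∑₅ f₂ ≡ ∑₅ f
  S₂ = trans (∑₅-rotate f₁) S₁
  S₃ : ∑₅ f₃ ≡ ∑₅ f
  S₃ = trans (∑₅-rotate f₂) S₂
  S₄ : ∑₅ f₄ ≡ ∑₅ f
  S₄ = trans (∑₅-rotate f₃) S₃
  five : ∀ s → s + (s + (s + (s + s))) ≡ + 5 / 1 * s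
  five = solve-∀ ℚ-ring


-- Weighted 5-cycles

count : List Bool → ℚ
count = foldr (λ b s → ⟦ b ⟧ + s) 0ℚ

-- Either at most one entry is true or x = 0. Letting x vanish instead of forbidding coincidences
-- admits degenerate tuples, whose cycle weight is zero.
exclusive : ∀ {x} → 0ℚ ≤ x → ∀ bs →
  AllPairs (λ p q → p ≡ true → q ≡ true → x ≡ 0ℚ) bs → count bs * x ≤ x
exclusive {x} 0≤x [] [] = subst (_≤ x) (sym (*-zeroˡ x)) 0≤x
exclusive {x} 0≤x (false ∷ bs) (_ ∷ ps) =
  subst (λ s → s * x ≤ x) (sym (+-identityˡ (count bs))) (exclusive 0≤x bs ps)
exclusive {x} 0≤x (true ∷ bs) (p ∷ _) = ≤-reflexive (begin
  (1ℚ + count bs) * x  ≡⟨ *-distribʳ-+ x 1ℚ (count bs) ⟩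
  1ℚ * x + count bs * x ≡⟨ cong₂ _+_ (*-identityˡ x) (none bs p) ⟩
  x + 0ℚ               ≡⟨ +-identityʳ x ⟩
  x                    ∎)
  where
  open ≡-Reasoning
  none : ∀ bs → All (λ q → true ≡ true → q ≡ true → x ≡ 0ℚ) bs → count bs * x ≡ 0ℚ
  none [] [] = *-zeroˡ x
  none (false ∷ bs) (_ ∷ ps) = trans (cong (_* x) (+-identityˡ (count bs))) (none bs ps)
  none (true ∷ bs) (p ∷ _) = trans (cong (count (true ∷ bs) *_) (p refl refl)) (*-zeroʳ (count (true ∷ bs)))

-- With a zero diagonal, sums over edges become sums over all ordered pairs, without reference to an
-- order on the vertices. Each edge then counts twice, so mass 1 means `total` 2.
record IsWeight {n : ℕ} (w : Fin n → Fin n → ℚ) : Set where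
  field
    symmetric : ∀ i j → w i j ≡ w j i
    nonneg    : ∀ i j → 0ℚ ≤ w i j
    loopless  : ∀ i → w i i ≡ 0ℚ
open IsWeight

total : (Fin n → Fin n → ℚ) → ℚ
total w = ∑ λ i → ∑ λ j → w i j

-- Only the five chords are tested: looplessness takes care of the five sides.
apart : Fin n → Fin n → Fin n → Fin n → Fin n → ℚ
apart a b c d e = N a c * N b d * N c e * N d a * N e b

closing : (Fin n → Fin n → ℚ) → Fin n → Fin n → Fin n → Fin n → Fin n → ℚ
closing w a b c d e = w b c * w c d * w d e * w e a * apart a b c d e

cycle : (Fin n → Fin n → ℚ) → Fin n → Fin n → Fin n → Fin n → Fin n → ℚ
cycle w a b c d e = w a b * closing w a b c d e

-- Every 5-cycle is counted ten times, once per dihedral relabelling.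
cycles : (Fin n → Fin n → ℚ) → ℚ
cycles w = ∑₅ (cycle w)

-- For a ≠ b this is P(ab). On the diagonal it sums closed 4-cycles instead, but in `cycles` it is
-- then multiplied by w a a = 0.
paths : (Fin n → Fin n → ℚ) → Fin n → Fin n → ℚ
paths w a b = ∑ λ c → ∑ λ d → ∑ λ e → closing w a b c d e

cycles≡∑paths : ∀ (w : Fin n → Fin n → ℚ) → cycles w ≡ ∑ λ a → ∑ λ b → w a b * paths w a b
cycles≡∑paths w = ∑-cong λ a → ∑-cong λ b → sym (*-∑₃ (w a b) (closing w a b))

cycle-rotate : ∀ (w : Fin n → Fin n → ℚ) a b c d e → cycle w a b c d e ≡ cycle w b c d e a
cycle-rotate w a b c d e =
  eq (w a b) (w b c) (w c d) (w d e) (w e a) (N a c) (N b d) (N c e) (N d a) (N e b)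
  where
  eq : ∀ w₁ w₂ w₃ w₄ w₅ n₁ n₂ n₃ n₄ n₅ →
    w₁ * (w₂ * w₃ * w₄ * w₅ * (n₁ * n₂ * n₃ * n₄ * n₅))
    ≡ w₂ * (w₃ * w₄ * w₅ * w₁ * (n₂ * n₃ * n₄ * n₅ * n₁))
  eq = solve-∀ ℚ-ring

0≤apart : ∀ (a b c d e : Fin n) → 0ℚ ≤ apart a b c d e
0≤apart a b c d e =
  0≤* (0≤* (0≤* (0≤* (0≤N a c) (0≤N b d)) (0≤N c e)) (0≤N d a)) (0≤N e b)

module _ {w : Fin n → Fin n → ℚ} (W : IsWeight w) where

  0≤closing : ∀ a b c d e → 0ℚ ≤ closing w a b c d e
  0≤closing a b c d e =
    0≤* (0≤* (0≤* (0≤* (nonneg W b c) (nonneg W c d)) (nonneg W d e)) (nonneg W e a))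
        (0≤apart a b c d e)

  0≤cycle : ∀ a b c d e → 0ℚ ≤ cycle w a b c d e
  0≤cycle a b c d e = 0≤* (nonneg W a b) (0≤closing a b c d e)

  closing-reflect : ∀ a b c d e → closing w a b c d e ≡ closing w b a e d c
  closing-reflect a b c d e = trans
    (cong₂ _*_
      (cong₂ _*_ (cong₂ _*_ (cong₂ _*_ (symmetric W b c) (symmetric W c d)) (symmetric W d e))
                 (symmetric W e a))
      (cong₂ _*_ (cong₂ _*_ (cong₂ _*_ (cong₂ _*_ (N-sym a c) (N-sym b d)) (N-sym c e))
                            (N-sym d a)) (N-sym e b)))
    (eq (w c b) (w d c) (w e d) (w a e) (N c a) (N d b) (N e c) (N a d) (N b e))
    where
    eq : ∀ w₁ w₂ w₃ w₄ n₁ n₂ n₃ n₄ n₅ →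
      w₁ * w₂ * w₃ * w₄ * (n₁ * n₂ * n₃ * n₄ * n₅)
      ≡ w₄ * w₃ * w₂ * w₁ * (n₅ * n₄ * n₃ * n₂ * n₁)
    eq = solve-∀ ℚ-ring

  cycle-reflect : ∀ a b c d e → cycle w a b c d e ≡ cycle w a e d c b
  cycle-reflect a b c d e = trans
    (cong₂ _*_ (symmetric W a b) (closing-reflect a b c d e))
    (sym (trans (cycle-rotate w a e d c b) (trans (cycle-rotate w e d c b a)
      (trans (cycle-rotate w d c b a e) (cycle-rotate w c b a e d)))))

  paths-sym : ∀ a b → paths w a b ≡ paths w b a
  paths-sym a b = trans
    (∑-cong λ c → ∑-cong λ d → ∑-cong λ e → closing-reflect a b c d e)
    (trans (∑-inward₃ (λ c d e → closing w b a e d c))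
           (∑-swap (λ d e → ∑ λ c → closing w b a e d c)))

  -- Transported along rotations, the two exclusions cover all ten pairs of rotations of a tuple.
  rotation-bound : (φ : Fin n → Fin n → Fin n → Fin n → Fin n → Bool) →
    (∀ a b c d e → φ a b c d e ≡ true → φ b c d e a ≡ true → cycle w a b c d e ≡ 0ℚ) →
    (∀ a b c d e → φ a b c d e ≡ true → φ c d e a b ≡ true → cycle w a b c d e ≡ 0ℚ) →
    + 5 / 1 * ∑₅ (λ a b c d e → ⟦ φ a b c d e ⟧ * cycle w a b c d e) ≤ cycles w
  rotation-bound φ excl₁ excl₂ = subst (_≤ cycles w) (∑₅-rotations f₀) (∑₅-mono pointwise)
    where
    Tuple→ : Set → Set
    Tuple→ X = Fin n → Fin n → Fin n → Fin n → Fin n → X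
    f₀ f₁ f₂ f₃ f₄ : Tuple→ ℚ
    f₀ a b c d e = ⟦ φ a b c d e ⟧ * cycle w a b c d e
    f₁ a b c d e = f₀ b c d e a
    f₂ a b c d e = f₀ c d e a b
    f₃ a b c d e = f₀ d e a b c
    f₄ a b c d e = f₀ e a b c d

    rot₁ : ∀ a b c d e → cycle w a b c d e ≡ cycle w b c d e a
    rot₁ = cycle-rotate w
    rot₂ : ∀ a b c d e → cycle w a b c d e ≡ cycle w c d e a b
    rot₂ a b c d e = trans (rot₁ a b c d e) (rot₁ b c d e a)
    rot₃ : ∀ a b c d e → cycle w a b c d e ≡ cycle w d e a b c
    rot₃ a b c d e = trans (rot₂ a b c d e) (rot₁ c d e a b)
    rot₄ : ∀ a b c d e → cycle w a b c d e ≡ cycle w e a b c d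
    rot₄ a b c d e = trans (rot₃ a b c d e) (rot₁ d e a b c)

    pointwise : ∀ a b c d e →
      f₀ a b c d e + (f₁ a b c d e + (f₂ a b c d e + (f₃ a b c d e + f₄ a b c d e)))
      ≤ cycle w a b c d e
    pointwise a b c d e = subst (_≤ x) to-sum (exclusive (0≤cycle a b c d e) bs
      ( (excl₁ a b c d e ∷ excl₂ a b c d e
          ∷ (λ p q → trans (rot₃ a b c d e) (excl₂ d e a b c q p))
          ∷ (λ p q → trans (rot₄ a b c d e) (excl₁ e a b c d q p)) ∷ [])
      ∷ ((λ p q → trans (rot₁ a b c d e) (excl₁ b c d e a p q))
          ∷ (λ p q → trans (rot₁ a b c d e) (excl₂ b c d e a p q))
          ∷ (λ p q → trans (rot₄ a b c d e) (excl₂ e a b c d q p)) ∷ [])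
      ∷ ((λ p q → trans (rot₂ a b c d e) (excl₁ c d e a b p q))
          ∷ (λ p q → trans (rot₂ a b c d e) (excl₂ c d e a b p q)) ∷ [])
      ∷ ((λ p q → trans (rot₃ a b c d e) (excl₁ d e a b c p q)) ∷ [])
      ∷ [] ∷ []))
      where
      x : ℚ
      x = cycle w a b c d e
      bs : List Bool
      bs = φ a b c d e ∷ φ b c d e a ∷ φ c d e a b ∷ φ d e a b c ∷ φ e a b c d ∷ []
      eq : ∀ p q r s t x → (p + (q + (r + (s + (t + 0ℚ))))) * x
        ≡ p * x + (q * x + (r * x + (s * x + t * x)))
      eq = solve-∀ ℚ-ring
      to-sum : count bs * x
        ≡ f₀ a b c d e + (f₁ a b c d e + (f₂ a b c d e + (f₃ a b c d e + f₄ a b c d e)))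
      to-sum = trans (eq ⟦ φ a b c d e ⟧ ⟦ φ b c d e a ⟧ ⟦ φ c d e a b ⟧ ⟦ φ d e a b c ⟧ ⟦ φ e a b c d ⟧ x)
        (cong (λ s → f₀ a b c d e + s)
          (cong₂ _+_ (cong (⟦ φ b c d e a ⟧ *_) (rot₁ a b c d e))
          (cong₂ _+_ (cong (⟦ φ c d e a b ⟧ *_) (rot₂ a b c d e))
          (cong₂ _+_ (cong (⟦ φ d e a b c ⟧ *_) (rot₃ a b c d e))
                     (cong (⟦ φ e a b c d ⟧ *_) (rot₄ a b c d e))))))

  -- The sum collects the tuples with v in first place. In a tuple of nonzero weight v occurs at
  -- most once: adjacent repetitions give a loop, the others a vanishing chord factor. Hence the
  -- five rotated conditions are exclusive. This is the source of the degree bound 2/5.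
  paths-through : ∀ v → + 5 / 1 * ∑ (λ j → w v j * paths w v j) ≤ cycles w
  paths-through v = subst (λ s → + 5 / 1 * s ≤ cycles w) sum≡
    (rotation-bound (λ a b c d e → does (v ≟ a)) excl₁ excl₂)
    where
    recover : ∀ {a} → does (v ≟ a) ≡ true → v ≡ a
    recover {a} eq with v ≟ a
    ... | yes p = p
    ... | no  _ with () ← eq
    excl₁ : ∀ a b c d e → does (v ≟ a) ≡ true → does (v ≟ b) ≡ true → cycle w a b c d e ≡ 0ℚ
    excl₁ a b c d e p q with refl ← recover p | refl ← recover q =
      trans (cong (_* closing w v v c d e) (loopless W v)) (*-zeroˡ (closing w v v c d e))
    excl₂ : ∀ a b c d e → does (v ≟ a) ≡ true → does (v ≟ c) ≡ true → cycle w a b c d e ≡ 0ℚ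
    excl₂ a b c d e p q with refl ← recover p | refl ← recover q =
      trans (cong (λ z → w v b * (w b v * w v d * w d e * w e v * (z * N b d * N v e * N d v * N e b)))
                  (N-refl v))
            (eq (w v b) (w b v * w v d * w d e * w e v) (N b d) (N v e) (N d v) (N e b))
      where
      eq : ∀ p q r s t u → p * (q * (0ℚ * r * s * t * u)) ≡ 0ℚ
      eq = solve-∀ ℚ-ring
    sum≡ : ∑₅ (λ a b c d e → δ v a * cycle w a b c d e) ≡ ∑ λ j → w v j * paths w v j
    sum≡ = trans
      (∑-cong λ a → trans (∑-cong λ b → sym (*-∑₃ (δ v a) (cycle w a b)))
        (sym (*-∑ (δ v a) (λ b → ∑ λ c → ∑ λ d → ∑ (cycle w a b c d)))))
      (trans (∑-δ v (λ a → ∑ λ b → ∑ λ c → ∑ λ d → ∑ λ e → cycle w a b c d e))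
             (∑-cong λ b → sym (*-∑₃ (w v b) (closing w v b))))

-- Bounding the 4-edge paths between two vertices

degree : (Fin n → Fin n → ℚ) → Fin n → ℚ
degree w v = ∑ (w v)

-- Deletes the edges at v but keeps the vertex, so that the index type stays the same.
isolate : Fin n → (Fin n → Fin n → ℚ) → Fin n → Fin n → ℚ
isolate v w i j = N v i * N v j * w i j

N*N-idem : ∀ (i j : Fin n) → N i j * N i j ≡ N i j
N*N-idem i j = ⟦⟧-idem (not (does (i ≟ j)))

N+δ : ∀ (i j : Fin n) → N i j + δ i j ≡ 1ℚ
N+δ i j = ⟦⟧-not (does (i ≟ j))

module _ {w : Fin n → Fin n → ℚ} (W : IsWeight w) where

  absorb : ∀ i j → N i j * w i j ≡ w i j
  absorb i j with i ≟ j
  ... | yes refl = trans (*-zeroˡ (w i i)) (sym (loopless W i))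
  ... | no  _    = *-identityˡ (w i j)

  isolate-isWeight : ∀ v → IsWeight (isolate v w)
  isolate-isWeight v = record
    { symmetric = λ i j → cong₂ _*_ (*-comm (N v i) (N v j)) (symmetric W i j)
    ; nonneg    = λ i j → 0≤* (0≤* (0≤N v i) (0≤N v j)) (nonneg W i j)
    ; loopless  = λ i → trans (cong (N v i * N v i *_) (loopless W i)) (*-zeroʳ (N v i * N v i))
    }

  isolate-≤ : ∀ v i j → isolate v w i j ≤ w i j
  isolate-≤ v i j = subst (isolate v w i j ≤_) (*-identityˡ (w i j))
    (*-monoʳ-≤-nonNeg (w i j) {{nonNegative (nonneg W i j)}}
      (*-mono-≤ (0≤const 1ℚ) (0≤N v j) (N≤1 v i) (N≤1 v j)))

  -- The ordered pairs are split into i = v, then j = v with i ≠ v, then neither. The first two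
  -- classes both sum to the degree of v, by symmetry and w v v = 0.
  total-isolate : ∀ v → total w ≡ degree w v + degree w v + total (isolate v w)
  total-isolate v = begin
    total w
      ≡⟨ (∑-cong λ i → ∑-cong λ j → split i j) ⟩
    ∑ (λ i → ∑ λ j → δ v i * w i j + N v i * (δ v j * w i j) + isolate v w i j)
      ≡⟨ (∑-cong λ i → trans (∑-+ (λ j → δ v i * w i j + N v i * (δ v j * w i j)) (isolate v w i))
           (cong (λ s → s + ∑ (isolate v w i))
             (trans (∑-+ (λ j → δ v i * w i j) (λ j → N v i * (δ v j * w i j)))
               (cong₂ _+_ (sym (*-∑ (δ v i) (w i)))
                 (trans (sym (*-∑ (N v i) (λ j → δ v j * w i j)))
                   (cong (N v i *_) (∑-δ v (w i)))))))) ⟩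
    ∑ (λ i → δ v i * degree w i + N v i * w i v + ∑ (isolate v w i))
      ≡⟨ trans (∑-+ (λ i → δ v i * degree w i + N v i * w i v) (λ i → ∑ (isolate v w i)))
           (cong (λ s → s + total (isolate v w))
             (trans (∑-+ (λ i → δ v i * degree w i) (λ i → N v i * w i v))
               (cong₂ _+_ (∑-δ v (degree w))
                 (∑-cong λ i → trans (cong (N v i *_) (symmetric W i v)) (absorb v i))))) ⟩
    degree w v + degree w v + total (isolate v w) ∎
    where
    open ≡-Reasoning
    rearrange : ∀ d₁ n₁ d₂ n₂ x →
      (n₁ * (n₂ + d₂) + d₁) * x ≡ d₁ * x + n₁ * (d₂ * x) + n₁ * n₂ * x
    rearrange = solve-∀ ℚ-ring
    split : ∀ i j → w i j ≡ δ v i * w i j + N v i * (δ v j * w i j) + isolate v w i j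
    split i j = trans (sym (*-identityˡ (w i j)))
      (trans (cong (_* w i j) (sym (trans
          (cong (λ s → s + δ v i) (trans (cong (N v i *_) (N+δ v j)) (*-identityʳ (N v i))))
          (N+δ v i))))
        (rearrange (δ v i) (N v i) (δ v j) (N v j) (w i j)))

  0≤total : 0ℚ ≤ total w
  0≤total = 0≤∑ λ i → 0≤∑ λ j → nonneg W i j

-- M is any common bound on the edge masses, not the mass of xy: the estimate is needed for the
-- heaviest edge and, in `β≤M/54`, for every edge.
module PathBound {w : Fin n → Fin n → ℚ} (W : IsWeight w) (total≡2 : total w ≡ 1ℚ + 1ℚ)
  {M : ℚ} (0≤M : 0ℚ ≤ M) (w≤M : ∀ i j → w i j ≤ M) {x y : Fin n} (x≢y : x ≢ y) where

  -- Isolating x, y, c and e one after the other makes the edges counted by Sx, Sy, w₂ c and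
  -- w₃ c e pairwise distinct and different from xy, so that their total weight is at most 1.
  private
    w₁ w₂ : Fin n → Fin n → ℚ
    w₁ = isolate x w
    w₂ = isolate y w₁
    w₃ : Fin n → Fin n → Fin n → ℚ
    w₃ c = isolate c w₂
    W₁ : IsWeight w₁
    W₁ = isolate-isWeight W x
    W₂ : IsWeight w₂
    W₂ = isolate-isWeight W₁ y
    W₃ : ∀ c → IsWeight (w₃ c)
    W₃ = isolate-isWeight W₂

    f g : Fin n → ℚ
    f c = N x c * w y c
    g e = N y e * w x e

    0≤f : ∀ c → 0ℚ ≤ f c
    0≤f c = 0≤* (0≤N x c) (nonneg W y c)
    0≤g : ∀ e → 0ℚ ≤ g e
    0≤g e = 0≤* (0≤N y e) (nonneg W x e)

  Sx Sy σ h t : ℚ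
  Sx = ∑ g
  Sy = ∑ f
  σ = ½ * (Sx + Sy)
  h = ½ * (1ℚ - (Sx + Sy + w x y))
  t = (h * h) ⊓ ((M * h) ⊓ (M * M + (h - M) * (h - M)))

  0≤Sx : 0ℚ ≤ Sx
  0≤Sx = 0≤∑ 0≤g
  0≤Sy : 0ℚ ≤ Sy
  0≤Sy = 0≤∑ 0≤f
  0≤σ : 0ℚ ≤ σ
  0≤σ = 0≤* (0≤const ½) (0≤+ 0≤Sx 0≤Sy)

  degree-split : ∀ {x y} → degree w x ≡ ∑ (λ j → N y j * w x j) + w x y
  degree-split {x} {y} = trans
    (∑-cong λ j → trans (sym (*-identityˡ (w x j)))
      (trans (cong (_* w x j) (sym (N+δ y j))) (*-distribʳ-+ (w x j) (N y j) (δ y j))))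
    (trans (∑-+ (λ j → N y j * w x j) (λ j → δ y j * w x j))
      (cong (λ s → ∑ (λ j → N y j * w x j) + s) (∑-δ y (w x))))

  degree-x : degree w x ≡ Sx + w x y
  degree-x = degree-split

  degree-y : degree w y ≡ Sy + w x y
  degree-y = trans degree-split (cong (λ s → Sy + s) (symmetric W y x))

  private
    degree₁-y : degree w₁ y ≡ Sy
    degree₁-y = ∑-cong λ j →
      cong (_* w y j) (trans (cong (_* N x j) (N-≢ x≢y)) (*-identityˡ (N x j)))

    budget : ∀ c e → Sx + Sy + w x y + (∑ (w₂ c) + ∑ (w₃ c e)) ≤ 1ℚ
    budget c e = by-gap (0≤* (0≤const ½) (0≤total (isolate-isWeight (W₃ c) e))) (trans
      (cong (λ s → s - (Sx + Sy + w x y + (∑ (w₂ c) + ∑ (w₃ c e)))) (sym half))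
      (eq Sy (∑ (w₂ c)) (∑ (w₃ c e)) (total (isolate e (w₃ c))) Sx (w x y)))
      where
      expand : total w ≡ (Sx + w x y) + (Sx + w x y) + (Sy + Sy + (∑ (w₂ c) + ∑ (w₂ c)
                 + (∑ (w₃ c e) + ∑ (w₃ c e) + total (isolate e (w₃ c)))))
      expand = trans (total-isolate W x) (cong₂ _+_ (cong₂ _+_ degree-x degree-x)
              (trans (total-isolate W₁ y) (cong₂ _+_ (cong₂ _+_ degree₁-y degree₁-y)
              (trans (total-isolate W₂ c) (cong (λ s → ∑ (w₂ c) + ∑ (w₂ c) + s)
                (total-isolate (W₃ c) e))))))
      half : ½ * ((Sx + w x y) + (Sx + w x y) + (Sy + Sy + (∑ (w₂ c) + ∑ (w₂ c)
                 + (∑ (w₃ c e) + ∑ (w₃ c e) + total (isolate e (w₃ c)))))) ≡ 1ℚ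
      half = cong (½ *_) (trans (sym expand) total≡2)
      eq : ∀ b u v r a m →
        ½ * ((a + m) + (a + m) + (b + b + (u + u + (v + v + r)))) - (a + b + m + (u + v)) ≡ ½ * r
      eq = solve-∀ ℚ-ring

    -- The indicators hidden in `f`, `g`, `w₂` and `w₃` are those of `apart`, some squared, together
    -- with indicators on the four sides of the path. Squares collapse by idempotence, and those on
    -- sides are absorbed by looplessness.
    closing-split : ∀ c d e → closing w x y c d e ≡ f c * g e * (w₂ c d * w₃ c e d)
    closing-split c d e = sym (begin
      f c * g e * (w₂ c d * w₃ c e d)
        ≡⟨ regroup (N x c) (w y c) (N y e) (w x e) (N y c) (N y d) (N x d) (w c d)
             (N c e) (N c d) (N x e) (w e d) ⟩
      (N y c * w y c) * (N c d * w c d) * w e d * (N x e * w x e)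
        * (N x c * N x c * (N y d * N y d) * N c e * (N x d * N x d) * (N y e * N y e))
        ≡⟨ cong₂ _*_
             (cong₂ _*_ (cong₂ _*_ (cong₂ _*_ (absorb W y c) (absorb W c d)) (symmetric W e d))
                        (trans (absorb W x e) (symmetric W x e)))
             (cong₂ _*_ (cong₂ _*_ (cong (_* N c e) (cong₂ _*_ (N*N-idem x c) (N*N-idem y d)))
                        (trans (N*N-idem x d) (N-sym x d))) (trans (N*N-idem y e) (N-sym y e))) ⟩
      closing w x y c d e ∎)
      where
      open ≡-Reasoning
      regroup : ∀ xc wyc ye wxe yc yd xd wcd ce cd xe wed →
        xc * wyc * (ye * wxe) * (yc * yd * (xc * xd * wcd) * (ce * cd * (ye * yd * (xe * xd * wed))))
        ≡ (yc * wyc) * (cd * wcd) * wed * (xe * wxe)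
          * (xc * xc * (yd * yd) * ce * (xd * xd) * (ye * ye))
      regroup = solve-∀ ℚ-ring

    T : Fin n → Fin n → ℚ
    T c e = ∑ λ d → w₂ c d * w₃ c e d

    paths-split : paths w x y ≡ ∑ λ c → ∑ λ e → f c * g e * T c e
    paths-split = ∑-cong λ c → trans (∑-swap (λ d e → closing w x y c d e))
      (∑-cong λ e → trans (∑-cong λ d → closing-split c d e)
        (sym (*-∑ (f c * g e) (λ d → w₂ c d * w₃ c e d))))

    module _ (c e : Fin n) where
      -- Averaging the two edges that meet in d turns `T` into at most a sum of squares of entries
      -- bounded by M, with sum H ≤ h.
      p : Fin n → ℚ
      p d = ½ * (w₂ c d + w₃ c e d)
      H : ℚ
      H = ∑ p
      0≤p : ∀ d → 0ℚ ≤ p d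
      0≤p d = 0≤* (0≤const ½) (0≤+ (nonneg W₂ c d) (nonneg (W₃ c) e d))
      p≤M : ∀ d → p d ≤ M
      p≤M d = subst (p d ≤_) (eq M) (*-monoˡ-≤ (0≤const ½) (+-mono-≤ (w₂≤M c d)
        (≤-trans (isolate-≤ W₂ c e d) (w₂≤M e d))))
        where
        eq : ∀ M → ½ * (M + M) ≡ M
        eq = solve-∀ ℚ-ring
        w₂≤M : ∀ i j → w₂ i j ≤ M
        w₂≤M i j = ≤-trans (isolate-≤ W₁ y i j) (≤-trans (isolate-≤ W x i j) (w≤M i j))
      0≤H : 0ℚ ≤ H
      0≤H = 0≤∑ 0≤p
      H≤h : H ≤ h
      H≤h = by-gap (0≤* (0≤const ½) (p≤q⇒0≤q-p (budget c e)))
        (trans (cong (λ s → h - s) H≡) (eq (Sx + Sy + w x y) (∑ (w₂ c) + ∑ (w₃ c e))))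
        where
        H≡ : H ≡ ½ * (∑ (w₂ c) + ∑ (w₃ c e))
        H≡ = trans (sym (*-∑ ½ (λ d → w₂ c d + w₃ c e d))) (cong (½ *_) (∑-+ (w₂ c) (w₃ c e)))
        eq : ∀ a b → ½ * (1ℚ - a) - ½ * b ≡ ½ * (1ℚ - (a + b))
        eq = solve-∀ ℚ-ring
      T≤∑p² : T c e ≤ ∑ (λ d → p d * p d)
      T≤∑p² = ∑-mono λ d → am-gm (p d) (nonneg W₂ c d) (nonneg (W₃ c) e d)
        (≤-reflexive (eq (w₂ c d + w₃ c e d)))
        where
        eq : ∀ s → s ≡ ½ * s + ½ * s
        eq = solve-∀ ℚ-ring
      T≤H² : T c e ≤ H * H
      T≤H² = ≤-trans T≤∑p² (∑²≤² 0≤p)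
      -- The two-block expression at H increases to its value at h only once H ≥ M. For H ≤ M the
      -- bound H² is used: it is at most M², and if also h ≤ M then M² + (h - M)² exceeds h² by 2M(M
      -- - h).
      T≤two-blocks : T c e ≤ M * M + (h - M) * (h - M)
      T≤two-blocks with ≤-total M H | ≤-total M h
      ... | inj₁ M≤H | _ = ≤-trans T≤∑p² (≤-trans (∑²≤two-blocks 0≤p p≤M)
            (+-monoʳ-≤ (M * M) (square-mono (p≤q⇒0≤q-p M≤H) (+-monoˡ-≤ (- M) H≤h))))
      ... | inj₂ H≤M | inj₁ _ = ≤-trans T≤H² (≤-trans (square-mono 0≤H H≤M)
            (p≤p+q (M * M) (0≤square (h - M))))
      ... | inj₂ _ | inj₂ h≤M = ≤-trans T≤H² (≤-trans (square-mono 0≤H H≤h)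
            (by-gap (0≤* (0≤+ 0≤M 0≤M) (p≤q⇒0≤q-p h≤M)) (eq M h)))
        where
        eq : ∀ M h → M * M + (h - M) * (h - M) - h * h ≡ (M + M) * (M - h)
        eq = solve-∀ ℚ-ring
      T≤t : T c e ≤ t
      T≤t = ⊓-glb (≤-trans T≤H² (square-mono 0≤H H≤h))
        (⊓-glb (≤-trans T≤∑p² (≤-trans (∑²≤max*∑ 0≤p p≤M) (*-monoˡ-≤ 0≤M H≤h))) T≤two-blocks)

  0≤h : 0ℚ ≤ h
  -- H ≤ h holds for every choice of c and e; the vertex x serves as both.
  0≤h = ≤-trans (0≤H x x) (H≤h x x)

  0≤t : 0ℚ ≤ t
  0≤t = ≤-trans (0≤∑ λ d → 0≤* (nonneg W₂ x d) (nonneg (W₃ x) x d)) (T≤t x x)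

  paths≤σ²t : paths w x y ≤ σ * σ * t
  paths≤σ²t = ≤-trans (≤-reflexive paths-split) (≤-trans
    (∑-mono λ c → ∑-mono λ e → *-monoˡ-≤ (0≤* (0≤f c) (0≤g e)) (T≤t c e))
    (≤-trans (≤-reflexive factor)
      (*-monoʳ-≤-nonNeg t {{nonNegative 0≤t}}
        (am-gm σ 0≤Sy 0≤Sx (≤-reflexive (eq Sx Sy))))))
    where
    eq : ∀ a b → b + a ≡ ½ * (a + b) + ½ * (a + b)
    eq = solve-∀ ℚ-ring
    factor : ∑ (λ c → ∑ λ e → f c * g e * t) ≡ Sy * Sx * t
    factor = trans
      (∑-cong λ c → trans (sym (∑-* (λ e → f c * g e) t)) (cong (_* t) (sym (*-∑ (f c) g))))
      (trans (sym (∑-* (λ c → f c * Sx) t)) (cong (_* t) (sym (∑-* f Sx))))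

  -- With t ≤ Mh it remains to bound σ²h, which is at most (4/27)(σ + h)³; as σ + h ≤ 1/2, this is
  -- at most 1/54.
  paths≤M/54 : paths w x y ≤ + 1 / 54 * M
  paths≤M/54 = ≤-trans paths≤σ²t (≤-trans
    (*-monoˡ-≤ (0≤square σ) (≤-trans (p⊓q≤q (h * h) _) (p⊓q≤p (M * h) _)))
    (subst₂ _≤_ (eq₁ σ h M) (*-comm M (+ 1 / 54)) (*-monoˡ-≤ 0≤M σ²h≤1/54)))
    where
    eq₁ : ∀ σ h M → M * (σ * σ * h) ≡ σ * σ * (M * h)
    eq₁ = solve-∀ ℚ-ring
    s : ℚ
    s = σ + h
    s≤½ : s ≤ ½
    s≤½ = by-gap (0≤* (0≤const ½) (nonneg W x y)) (eq (Sx + Sy) (w x y))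
      where
      eq : ∀ a m → ½ - (½ * a + ½ * (1ℚ - (a + m))) ≡ ½ * m
      eq = solve-∀ ℚ-ring
    0≤s : 0ℚ ≤ s
    0≤s = 0≤+ 0≤σ 0≤h
    σ²h≤1/54 : σ * σ * h ≤ + 1 / 54
    σ²h≤1/54 = ≤-trans
      (by-gap (0≤* (0≤const (+ 1 / 27))
                (0≤* (0≤square (σ - (h + h))) (0≤+ (0≤* (0≤const (+ 4 / 1)) 0≤σ) 0≤h)))
              (eq σ h))
      (*-monoˡ-≤ (0≤const (+ 4 / 27))
        (*-mono-≤ (0≤const (+ 1 / 4)) 0≤s (square-mono 0≤s s≤½) s≤½))
      where
      eq : ∀ σ h → + 4 / 27 * ((σ + h) * (σ + h) * (σ + h)) - σ * σ * h
        ≡ + 1 / 27 * ((σ - (h + h)) * (σ - (h + h)) * (+ 4 / 1 * σ + h))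
      eq = solve-∀ ℚ-ring

-- Approximately critical weights

record IsUnitWeight {n : ℕ} (w : Fin n → Fin n → ℚ) : Set where
  field
    isWeight : IsWeight w
    total≡2  : total w ≡ 1ℚ + 1ℚ
open IsUnitWeight

-- Five times the b(μ; 5) of the paper: at a maximiser this is the value of paths on every edge.
β : (Fin n → Fin n → ℚ) → ℚ
β w = ½ * cycles w

maximum-edge : ∀ {w : Fin n → Fin n → ℚ} → IsUnitWeight w →
  ∃[ x ] ∃[ y ] (∀ i j → w i j ≤ w x y)
maximum-edge {zero} U with () ← total≡2 U
maximum-edge {suc n} {w} U = argmax₂ w

-- `β` is the average of `paths` with respect to the edge masses, so a bound on all edges passes to
-- it.
β≤M/54 : ∀ {w : Fin n → Fin n → ℚ} → IsUnitWeight w → ∀ {M} → 0ℚ ≤ M → (∀ i j → w i j ≤ M) →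
  β w ≤ + 1 / 54 * M
β≤M/54 {w = w} U {M} 0≤M w≤M = subst (β w ≤_) sum≡ (*-monoˡ-≤ (0≤const ½)
  (subst (_≤ ∑ λ i → ∑ λ j → w i j * (+ 1 / 54 * M)) (sym (cycles≡∑paths w))
    (∑-mono λ i → ∑-mono λ j → edge i j)))
  where
  W : IsWeight w
  W = isWeight U
  edge : ∀ i j → w i j * paths w i j ≤ w i j * (+ 1 / 54 * M)
  edge i j with i ≟ j
  ... | yes refl = ≤-reflexive (trans (cong (_* paths w i i) (loopless W i))
          (trans (*-zeroˡ (paths w i i)) (sym (trans (cong (_* (+ 1 / 54 * M)) (loopless W i))
            (*-zeroˡ (+ 1 / 54 * M))))))
  ... | no i≢j = *-monoˡ-≤ (nonneg W i j) (PathBound.paths≤M/54 W (total≡2 U) 0≤M w≤M i≢j)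
  sum≡ : ½ * ∑ (λ i → ∑ λ j → w i j * (+ 1 / 54 * M)) ≡ + 1 / 54 * M
  sum≡ = trans (cong (½ *_) (trans (∑-cong λ i → sym (∑-* (w i) (+ 1 / 54 * M)))
           (trans (sym (∑-* (λ i → ∑ (w i)) (+ 1 / 54 * M))) (cong (_* (+ 1 / 54 * M)) (total≡2 U)))))
         (eq (+ 1 / 54 * M))
    where
    eq : ∀ c → ½ * ((1ℚ + 1ℚ) * c) ≡ c
    eq = solve-∀ ℚ-ring

module Critical {w : Fin n → Fin n → ℚ} (U : IsUnitWeight w) {ε : ℚ}
  (0≤ε : 0ℚ ≤ ε) (ε-small : + 625 / 1 * ε ≤ + 1 / 100) (1/625≤β : + 1 / 625 ≤ β w)
  (paths≤ : ∀ i j → i ≢ j → paths w i j ≤ β w + ε) where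

  private
    W : IsWeight w
    W = isWeight U

    x y : Fin n
    x = proj₁ (maximum-edge U)
    y = proj₁ (proj₂ (maximum-edge U))
    M : ℚ
    M = w x y
    w≤M : ∀ i j → w i j ≤ M
    w≤M = proj₂ (proj₂ (maximum-edge U))
    0≤M : 0ℚ ≤ M
    0≤M = nonneg W x y

    54/625≤M : + 54 / 625 ≤ M
    54/625≤M = *-cancel (positive⁻¹ (+ 1 / 54)) (≤-trans 1/625≤β (β≤M/54 U 0≤M w≤M))

    x≢y : x ≢ y
    x≢y x≡y = <-irrefl refl (<-≤-trans (positive⁻¹ (+ 54 / 625))
      (≤-trans 54/625≤M (≤-reflexive (trans (cong (λ z → w z y) x≡y) (loopless W y)))))

    -- Quantitative complementary slackness. The entries are nonnegative and sum to 2ε because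
    -- `cycles` is 2β, so every row, and every single entry, is at most 2ε.
    slack : Fin n → Fin n → ℚ
    slack i j = w i j * (β w + ε) - w i j * paths w i j

    0≤slack : ∀ i j → 0ℚ ≤ slack i j
    0≤slack i j = by-cases (i ≟ j)
      where
      eq : ∀ a b → 0ℚ * a - 0ℚ * b ≡ 0ℚ
      eq = solve-∀ ℚ-ring
      by-cases : Dec (i ≡ j) → 0ℚ ≤ slack i j
      by-cases (yes refl) = ≤-reflexive (sym (trans
            (cong (λ z → z * (β w + ε) - z * paths w i i) (loopless W i)) (eq (β w + ε) (paths w i i))))
      by-cases (no i≢j) = p≤q⇒0≤q-p (*-monoˡ-≤ (nonneg W i j) (paths≤ i j i≢j))

    slack-row : ∀ i → ∑ (slack i) ≡ degree w i * (β w + ε) - ∑ (λ j → w i j * paths w i j)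
    slack-row i = trans (∑-- (λ j → w i j * (β w + ε)) (λ j → w i j * paths w i j))
      (cong (_- ∑ (λ j → w i j * paths w i j)) (sym (∑-* (w i) (β w + ε))))

    slack-total : ∑ (λ i → ∑ (slack i)) ≡ (1ℚ + 1ℚ) * ε
    slack-total = trans (∑-cong slack-row)
      (trans (∑-- (λ i → degree w i * (β w + ε)) (λ i → ∑ (λ j → w i j * paths w i j)))
      (trans (cong₂ _-_ (trans (sym (∑-* (degree w) (β w + ε))) (cong (_* (β w + ε)) (total≡2 U)))
                       (sym (cycles≡∑paths w)))
             (eq (cycles w) ε)))
      where
      eq : ∀ c ε → (1ℚ + 1ℚ) * (½ * c + ε) - c ≡ (1ℚ + 1ℚ) * ε
      eq = solve-∀ ℚ-ring

    row≤2ε : ∀ i → ∑ (slack i) ≤ (1ℚ + 1ℚ) * ε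
    row≤2ε i = subst (∑ (slack i) ≤_) slack-total (term≤∑ (λ i → 0≤∑ (0≤slack i)) i)

    κ : ℚ
    κ = + 1 / 5 + + 625 / 1 * ε

    -- With d the degree of v, the slack of row v and `paths-through` give d(β + ε) ≤ 2β/5 + 2ε.
    -- Hence (d - 2/5)β ≤ 2ε, and β ≥ 1/625 yields d ≤ 2/5 + 1250ε, which explains the 625 in `κ`.
    degree≤2κ : ∀ v → degree w v ≤ κ + κ
    degree≤2κ v = [ below , above ]′ (≤-total (degree w v) (+ 2 / 5))
      where
      below : degree w v ≤ + 2 / 5 → degree w v ≤ κ + κ
      below d≤2/5 = ≤-trans d≤2/5 (by-gap (0≤* (0≤const (+ 1250 / 1)) 0≤ε) (eq ε))
        where
        eq : ∀ ε → (+ 1 / 5 + + 625 / 1 * ε) + (+ 1 / 5 + + 625 / 1 * ε) - + 2 / 5 ≡ + 1250 / 1 * ε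
        eq = solve-∀ ℚ-ring
      above : + 2 / 5 ≤ degree w v → degree w v ≤ κ + κ
      above 2/5≤d = by-gap
        (0≤+ (0≤+ (0≤+ (0≤* (0≤const (+ 625 / 1)) (p≤q⇒0≤q-p row′))
              (0≤* (0≤const (+ 125 / 1)) (p≤q⇒0≤q-p (paths-through W v))))
              (0≤* (0≤const (+ 625 / 1)) (0≤* (p≤q⇒0≤q-p 2/5≤d) (p≤q⇒0≤q-p 1/625≤β))))
             (0≤* (0≤const (+ 625 / 1)) (0≤* (≤-trans (0≤const (+ 2 / 5)) 2/5≤d) 0≤ε)))
        (eq (degree w v) (cycles w) ε (∑ (λ j → w v j * paths w v j)))
        where
        row′ : degree w v * (β w + ε) - ∑ (λ j → w v j * paths w v j) ≤ (1ℚ + 1ℚ) * ε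
        row′ = subst (_≤ (1ℚ + 1ℚ) * ε) (slack-row v) (row≤2ε v)
        eq : ∀ d c ε b → (+ 1 / 5 + + 625 / 1 * ε) + (+ 1 / 5 + + 625 / 1 * ε) - d
          ≡ + 625 / 1 * ((1ℚ + 1ℚ) * ε - (d * (½ * c + ε) - b))
            + + 125 / 1 * (c - + 5 / 1 * b)
            + + 625 / 1 * ((d - + 2 / 5) * (½ * c - + 1 / 625))
            + + 625 / 1 * (d * ε)
        eq = solve-∀ ℚ-ring

    module PB = PathBound W (total≡2 U) 0≤M w≤M x≢y
    open PB using (Sx; Sy; σ; h; t)

    0<κ : 0ℚ < κ
    0<κ = <-≤-trans (positive⁻¹ (+ 1 / 5)) (p≤p+q (+ 1 / 5) (0≤* (0≤const (+ 625 / 1)) 0≤ε))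

    -- Here 5M ≥ 54/125, while smallness of ε keeps 2κ ≤ 21/50.
    2κ≤5M : + 2 / 1 * κ ≤ + 5 / 1 * M
    2κ≤5M = by-gap (0≤+ (0≤+ (0≤* (0≤const (+ 5 / 1)) (p≤q⇒0≤q-p 54/625≤M))
                             (0≤* (0≤const (+ 2 / 1)) (p≤q⇒0≤q-p ε-small)))
                        (0≤const (+ 54 / 125 - + 21 / 50))) (eq M ε)
      where
      eq : ∀ M ε → + 5 / 1 * M - + 2 / 1 * (+ 1 / 5 + + 625 / 1 * ε)
        ≡ + 5 / 1 * (M - + 54 / 625) + + 2 / 1 * (+ 1 / 100 - + 625 / 1 * ε) + (+ 54 / 125 - + 21 / 50)
      eq = solve-∀ ℚ-ring

    σ+M≤2κ : σ + M ≤ κ + κ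
    σ+M≤2κ = by-gap (0≤* (0≤const ½) (0≤+
        (p≤q⇒0≤q-p (subst (_≤ κ + κ) PB.degree-x (degree≤2κ x)))
        (p≤q⇒0≤q-p (subst (_≤ κ + κ) PB.degree-y (degree≤2κ y)))))
      (eq (κ + κ) Sx Sy M)
      where
      eq : ∀ k a b M → k - (½ * (a + b) + M) ≡ ½ * (k - (a + M) + (k - (b + M)))
      eq = solve-∀ ℚ-ring

    budget : σ + σ + (h + h) + M ≤ + 5 / 1 * κ
    budget = by-gap (0≤* (0≤const (+ 3125 / 1)) 0≤ε) (eq (Sx + Sy) M ε)
      where
      eq : ∀ a M ε → + 5 / 1 * (+ 1 / 5 + + 625 / 1 * ε)
        - (½ * a + ½ * a + (½ * (1ℚ - (a + M)) + ½ * (1ℚ - (a + M))) + M) ≡ + 3125 / 1 * ε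
      eq = solve-∀ ℚ-ring

    paths≤κ⁴ : paths w x y ≤ κ * κ * (κ * κ)
    paths≤κ⁴ = ≤-trans PB.paths≤σ²t (KeyInequality.key-inequality 0<κ PB.0≤σ 0≤M PB.0≤h PB.0≤t
      2κ≤5M σ+M≤2κ budget (p⊓q≤p (h * h) rest₁)
      (≤-trans (p⊓q≤q (h * h) rest₁) (p⊓q≤p (M * h) rest₂))
      (λ _ → ≤-trans (p⊓q≤q (h * h) rest₁) (p⊓q≤q (M * h) rest₂)))
      where
      rest₁ rest₂ : ℚ
      rest₂ = M * M + (h - M) * (h - M)
      rest₁ = (M * h) ⊓ rest₂

    -- For 0 ≤ z ≤ 1 the powers of z in (1/5 + z)⁴ are replaced by z; the coefficients then add up
    -- to 259/125 < 3.
    κ⁴≤ : κ * κ * (κ * κ) ≤ + 1 / 625 + + 3 / 1 * (+ 625 / 1 * ε)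
    κ⁴≤ = by-gap
      (0≤* 0≤z (0≤+ (0≤+ (0≤+ (0≤const (+ 116 / 125)) (0≤* (0≤const (+ 6 / 25)) 0≤1-z))
                    (0≤* (0≤const (+ 4 / 5)) (0≤* 0≤1-z (0≤+ (0≤const 1ℚ) 0≤z))))
                    (0≤* 0≤1-z (0≤+ (0≤+ (0≤const 1ℚ) 0≤z) (0≤square z)))))
      (eq z)
      where
      z : ℚ
      z = + 625 / 1 * ε
      0≤z : 0ℚ ≤ z
      0≤z = 0≤* (0≤const (+ 625 / 1)) 0≤ε
      0≤1-z : 0ℚ ≤ 1ℚ - z
      0≤1-z = p≤q⇒0≤q-p (≤-trans ε-small (≤ᵇ⇒≤ {+ 1 / 100} {1ℚ} _))
      eq : ∀ z → + 1 / 625 + + 3 / 1 * z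
          - (+ 1 / 5 + z) * (+ 1 / 5 + z) * ((+ 1 / 5 + z) * (+ 1 / 5 + z))
        ≡ z * (+ 116 / 125 + + 6 / 25 * (1ℚ - z) + + 4 / 5 * ((1ℚ - z) * (1ℚ + z))
               + (1ℚ - z) * (1ℚ + z + z * z))
      eq = solve-∀ ℚ-ring

    M*gap≤2ε : M * (β w + ε) - M * paths w x y ≤ (1ℚ + 1ℚ) * ε
    M*gap≤2ε = ≤-trans (term≤∑ (0≤slack x) y) (row≤2ε x)

    -- A single slack entry gives M(β + ε - P) ≤ 2ε for the heaviest edge, and M ≥ 54/625 > 1/12.
    β≤paths+24ε : β w ≤ paths w x y + + 24 / 1 * ε
    β≤paths+24ε = [ (λ β≤p → ≤-trans β≤p (p≤p+q (paths w x y) (0≤* (0≤const (+ 24 / 1)) 0≤ε)))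
                  , above ]′ (≤-total (β w) (paths w x y))
      where
      0≤M-1/12 : 0ℚ ≤ M - + 1 / 12
      0≤M-1/12 = p≤q⇒0≤q-p (≤-trans (≤ᵇ⇒≤ {+ 1 / 12} {+ 54 / 625} _) 54/625≤M)
      eq : ∀ b p ε M → + 1 / 12 * (p + + 24 / 1 * ε) - + 1 / 12 * b
        ≡ (1ℚ + 1ℚ) * ε - (M * (b + ε) - M * p) + (M - + 1 / 12) * (b - p) + M * ε
      eq = solve-∀ ℚ-ring
      above : paths w x y ≤ β w → β w ≤ paths w x y + + 24 / 1 * ε
      above p≤β = *-cancel (positive⁻¹ (+ 1 / 12)) (by-gap
        (0≤+ (0≤+ (p≤q⇒0≤q-p M*gap≤2ε) (0≤* 0≤M-1/12 (p≤q⇒0≤q-p p≤β))) (0≤* 0≤M 0≤ε))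
        (eq (β w) (paths w x y) ε M))

  -- The constant is 3 · 625 + 24, rounded up.
  critical-bound : β w ≤ + 1 / 625 + + 1900 / 1 * ε
  critical-bound = ≤-trans β≤paths+24ε (≤-trans (+-monoˡ-≤ (+ 24 / 1 * ε) (≤-trans paths≤κ⁴ κ⁴≤))
    (by-gap 0≤ε (eq ε)))
    where
    eq : ∀ ε → + 1 / 625 + + 1900 / 1 * ε - (+ 1 / 625 + + 3 / 1 * (+ 625 / 1 * ε) + + 24 / 1 * ε) ≡ ε
    eq = solve-∀ ℚ-ring

-- Moving mass to an edge

apart-rotate : ∀ (a b c d e : Fin n) → apart b c d e a ≡ apart a b c d e
apart-rotate a b c d e = eq (N b d) (N c e) (N d a) (N e b) (N a c)
  where
  eq : ∀ p q r s t → p * q * r * s * t ≡ t * p * q * r * s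
  eq = solve-∀ ℚ-ring

-- A and A′ stand for the terms of order 0 and 1 in b of a partial product X.
grow : ∀ A {A′ X a b} → 0ℚ ≤ A′ → 0ℚ ≤ a → 0ℚ ≤ b → A + A′ ≤ X →
  A * a + (A′ * a + A * b) ≤ X * (a + b)
grow A {A′} {X} {a} {b} 0≤A′ 0≤a 0≤b A+A′≤X = by-gap
  (0≤+ (0≤* (p≤q⇒0≤q-p A+A′≤X) (0≤+ 0≤a 0≤b)) (0≤* 0≤A′ 0≤b)) (eq A A′ X a b)
  where
  eq : ∀ A A′ X a b → X * (a + b) - (A * a + (A′ * a + A * b)) ≡ (X - (A + A′)) * (a + b) + A′ * b
  eq = solve-∀ ℚ-ring

module _ {u v : Fin n → Fin n → ℚ} (0≤u : ∀ i j → 0ℚ ≤ u i j) (0≤v : ∀ i j → 0ℚ ≤ v i j) where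

  private
    lin : Fin n → Fin n → Fin n → Fin n → Fin n → ℚ
    lin a b c d e = v a b * closing u a b c d e

  -- In the expansion of the product over the five sides only the terms with at most one factor from
  -- v are kept. The five linear terms are rotations of one term, which suits `∑₅-rotations`.
  cycle-first-order : ∀ a b c d e →
    cycle u a b c d e
      + (lin a b c d e + (lin b c d e a + (lin c d e a b + (lin d e a b c + lin e a b c d))))
    ≤ cycle (λ i j → u i j + v i j) a b c d e
  cycle-first-order a b c d e = subst₂ _≤_
    (trans (lower (u a b) (u b c) (u c d) (u d e) (u e a) (v a b) (v b c) (v c d) (v d e) (v e a) m)
      (cong (λ s → cycle u a b c d e + (v a b * closing u a b c d e + s))
        (cong₂ _+_ (cong (λ z → v b c * (u c d * u d e * u e a * u a b * z)) (sym m₁))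
        (cong₂ _+_ (cong (λ z → v c d * (u d e * u e a * u a b * u b c * z)) (sym m₂))
        (cong₂ _+_ (cong (λ z → v d e * (u e a * u a b * u b c * u c d * z)) (sym m₃))
                   (cong (λ z → v e a * (u a b * u b c * u c d * u d e * z)) (sym m₄)))))))
    (upper (u a b + v a b) (u b c + v b c) (u c d + v c d) (u d e + v d e) (u e a + v e a) m)
    (*-monoˡ-≤ (0≤apart a b c d e)
      (grow (u a b * u b c * u c d * u d e) 0≤A₄′ (0≤u e a) (0≤v e a)
      (grow (u a b * u b c * u c d) 0≤A₃′ (0≤u d e) (0≤v d e)
      (grow (u a b * u b c) 0≤A₂′ (0≤u c d) (0≤v c d)
      (grow (u a b) (0≤v a b) (0≤u b c) (0≤v b c) ≤-refl)))))
    where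
    m A₂′ A₃′ A₄′ : ℚ
    m = apart a b c d e
    A₂′ = v a b * u b c + u a b * v b c
    A₃′ = A₂′ * u c d + u a b * u b c * v c d
    A₄′ = A₃′ * u d e + u a b * u b c * u c d * v d e
    0≤A₂′ : 0ℚ ≤ A₂′
    0≤A₂′ = 0≤+ (0≤* (0≤v a b) (0≤u b c)) (0≤* (0≤u a b) (0≤v b c))
    0≤A₃′ : 0ℚ ≤ A₃′
    0≤A₃′ = 0≤+ (0≤* 0≤A₂′ (0≤u c d)) (0≤* (0≤* (0≤u a b) (0≤u b c)) (0≤v c d))
    0≤A₄′ : 0ℚ ≤ A₄′
    0≤A₄′ = 0≤+ (0≤* 0≤A₃′ (0≤u d e)) (0≤* (0≤* (0≤* (0≤u a b) (0≤u b c)) (0≤u c d)) (0≤v d e))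
    m₁ : apart b c d e a ≡ m
    m₁ = apart-rotate a b c d e
    m₂ : apart c d e a b ≡ m
    m₂ = trans (apart-rotate b c d e a) m₁
    m₃ : apart d e a b c ≡ m
    m₃ = trans (apart-rotate c d e a b) m₂
    m₄ : apart e a b c d ≡ m
    m₄ = trans (apart-rotate d e a b c) m₃
    lower : ∀ a₁ a₂ a₃ a₄ a₅ b₁ b₂ b₃ b₄ b₅ m →
      m * (a₁ * a₂ * a₃ * a₄ * a₅
        + ((((b₁ * a₂ + a₁ * b₂) * a₃ + a₁ * a₂ * b₃) * a₄ + a₁ * a₂ * a₃ * b₄) * a₅ + a₁ * a₂ * a₃ * a₄ * b₅))
      ≡ a₁ * (a₂ * a₃ * a₄ * a₅ * m)
        + (b₁ * (a₂ * a₃ * a₄ * a₅ * m) + (b₂ * (a₃ * a₄ * a₅ * a₁ * m)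
        + (b₃ * (a₄ * a₅ * a₁ * a₂ * m) + (b₄ * (a₅ * a₁ * a₂ * a₃ * m) + b₅ * (a₁ * a₂ * a₃ * a₄ * m)))))
    lower = solve-∀ ℚ-ring
    upper : ∀ s₁ s₂ s₃ s₄ s₅ m → m * (s₁ * s₂ * s₃ * s₄ * s₅) ≡ s₁ * (s₂ * s₃ * s₄ * s₅ * m)
    upper = solve-∀ ℚ-ring

  cycles-first-order :
    cycles u + + 5 / 1 * ∑ (λ a → ∑ λ b → v a b * paths u a b) ≤ cycles (λ i j → u i j + v i j)
  cycles-first-order = subst (_≤ cycles (λ i j → u i j + v i j))
    (trans (∑₅-+ (cycle u) (λ a b c d e →
        lin a b c d e + (lin b c d e a + (lin c d e a b + (lin d e a b c + lin e a b c d)))))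
      (cong (λ s → cycles u + s) (trans (∑₅-rotations lin)
        (cong (+ 5 / 1 *_) (∑-cong λ a → ∑-cong λ b → sym (*-∑₃ (v a b) (closing u a b)))))))
    (∑₅-mono cycle-first-order)

scale : ℚ → (Fin n → Fin n → ℚ) → Fin n → Fin n → ℚ
scale s w i j = s * w i j

closing-scale : ∀ s (w : Fin n → Fin n → ℚ) a b c d e →
  closing (scale s w) a b c d e ≡ s * s * (s * s) * closing w a b c d e
closing-scale s w a b c d e = eq s (w b c) (w c d) (w d e) (w e a) (apart a b c d e)
  where
  eq : ∀ s p q r t m → s * p * (s * q) * (s * r) * (s * t) * m ≡ s * s * (s * s) * (p * q * r * t * m)
  eq = solve-∀ ℚ-ring

cycles-scale : ∀ s (w : Fin n → Fin n → ℚ) → cycles (scale s w) ≡ s * (s * s * (s * s)) * cycles w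
cycles-scale s w = trans
  (∑₅-cong λ a b c d e → trans (cong (s * w a b *_) (closing-scale s w a b c d e))
    (eq s (s * s * (s * s)) (w a b) (closing w a b c d e)))
  (sym (*-∑₅ (s * (s * s * (s * s))) (cycle w)))
  where
  eq : ∀ s q p r → s * p * (q * r) ≡ s * q * (p * r)
  eq = solve-∀ ℚ-ring

paths-scale : ∀ s (w : Fin n → Fin n → ℚ) a b → paths (scale s w) a b ≡ s * s * (s * s) * paths w a b
paths-scale s w a b = trans
  (∑-cong λ c → ∑-cong λ d → ∑-cong λ e → closing-scale s w a b c d e)
  (sym (*-∑₃ (s * s * (s * s)) (closing w a b)))

edge : Fin n → Fin n → Fin n → Fin n → ℚ
edge x y i j = δ x i * δ y j + δ y i * δ x j

∑-edge : ∀ (x y : Fin n) (f : Fin n → Fin n → ℚ) →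
  ∑ (λ i → ∑ λ j → edge x y i j * f i j) ≡ f x y + f y x
∑-edge x y f = trans (∑-cong row)
  (trans (∑-+ (λ i → δ x i * f i y) (λ i → δ y i * f i x))
         (cong₂ _+_ (∑-δ x (λ i → f i y)) (∑-δ y (λ i → f i x))))
  where
  eq : ∀ p q r s z → (p * q + r * s) * z ≡ p * (q * z) + r * (s * z)
  eq = solve-∀ ℚ-ring
  row : ∀ i → ∑ (λ j → edge x y i j * f i j) ≡ δ x i * f i y + δ y i * f i x
  row i = trans (∑-cong λ j → eq (δ x i) (δ y j) (δ y i) (δ x j) (f i j))
    (trans (∑-+ (λ j → δ x i * (δ y j * f i j)) (λ j → δ y i * (δ x j * f i j)))
      (cong₂ _+_ (trans (sym (*-∑ (δ x i) (λ j → δ y j * f i j))) (cong (δ x i *_) (∑-δ y (f i))))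
                 (trans (sym (*-∑ (δ y i) (λ j → δ x j * f i j))) (cong (δ y i *_) (∑-δ x (f i))))))

-- A convex combination of w with the unit weight concentrated on the edge xy, so the total stays 2.
shift : ℚ → Fin n → Fin n → (Fin n → Fin n → ℚ) → Fin n → Fin n → ℚ
shift t x y w i j = (1ℚ - t) * w i j + t * edge x y i j

module _ {w : Fin n → Fin n → ℚ} (U : IsUnitWeight w) {x y : Fin n} (x≢y : x ≢ y)
  {t : ℚ} (0≤t : 0ℚ ≤ t) (t≤1 : t ≤ 1ℚ) where

  private
    W : IsWeight w
    W = isWeight U
    s : ℚ
    s = 1ℚ - t
    0≤s : 0ℚ ≤ s
    0≤s = p≤q⇒0≤q-p t≤1
    0≤edge : ∀ i j → 0ℚ ≤ edge x y i j
    0≤edge i j = 0≤+ (0≤* (0≤⟦⟧ (does (x ≟ i))) (0≤⟦⟧ (does (y ≟ j))))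
                     (0≤* (0≤⟦⟧ (does (y ≟ i))) (0≤⟦⟧ (does (x ≟ j))))

    edge-loop : ∀ i → edge x y i i ≡ 0ℚ
    edge-loop i with x ≟ i | y ≟ i
    ... | yes x≡i | yes y≡i = ⊥-elim (x≢y (trans x≡i (sym y≡i)))
    ... | yes _ | no _ = refl
    ... | no _ | yes _ = refl
    ... | no _ | no _ = refl

  shift-isUnitWeight : IsUnitWeight (shift t x y w)
  shift-isUnitWeight = record
    { isWeight = record
      { symmetric = λ i j → cong₂ (λ p q → s * p + t * q) (symmetric W i j)
          (trans (+-comm (δ x i * δ y j) (δ y i * δ x j))
                 (cong₂ _+_ (*-comm (δ y i) (δ x j)) (*-comm (δ x i) (δ y j))))
      ; nonneg = λ i j → 0≤+ (0≤* 0≤s (nonneg W i j)) (0≤* 0≤t (0≤edge i j))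
      ; loopless = λ i → trans (cong₂ (λ p q → s * p + t * q) (loopless W i) (edge-loop i)) (zero-eq s t)
      }
    ; total≡2 = trans
        (∑-cong λ i → trans (∑-+ (λ j → s * w i j) (λ j → t * edge x y i j))
          (cong₂ _+_ (sym (*-∑ s (w i))) (sym (*-∑ t (edge x y i)))))
        (trans (∑-+ (λ i → s * ∑ (w i)) (λ i → t * ∑ (edge x y i)))
        (trans (cong₂ _+_ (trans (sym (*-∑ s (λ i → ∑ (w i)))) (cong (s *_) (total≡2 U)))
                          (trans (sym (*-∑ t (λ i → ∑ (edge x y i)))) (cong (t *_) edge-total)))
               (two-eq t)))
    }
    where
    zero-eq : ∀ s t → s * 0ℚ + t * 0ℚ ≡ 0ℚ
    zero-eq = solve-∀ ℚ-ring
    two-eq : ∀ t → (1ℚ - t) * (1ℚ + 1ℚ) + t * (1ℚ + 1ℚ) ≡ 1ℚ + 1ℚ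
    two-eq = solve-∀ ℚ-ring
    edge-total : ∑ (λ i → ∑ (edge x y i)) ≡ 1ℚ + 1ℚ
    edge-total = trans (∑-cong λ i → ∑-cong λ j → sym (*-identityʳ (edge x y i j)))
      (∑-edge x y (λ _ _ → 1ℚ))

  -- The first-order inequality at (1 - t)w. The edge xy contributes in both orientations, which
  -- cancels the ½ in `β`.
  shift-gain : s * (s * s * (s * s)) * β w + + 5 / 1 * t * (s * s * (s * s)) * paths w x y
    ≤ β (shift t x y w)
  shift-gain = subst (_≤ β (shift t x y w))
    (trans (cong₂ (λ p q → ½ * (p + + 5 / 1 * q)) (cycles-scale s w) first-order)
      (eq (cycles w) (paths w x y) s t))
    (*-monoˡ-≤ (0≤const ½)
      (cycles-first-order (λ i j → 0≤* 0≤s (nonneg W i j)) (λ i j → 0≤* 0≤t (0≤edge i j))))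
    where
    first-order : ∑ (λ a → ∑ λ b → t * edge x y a b * paths (scale s w) a b)
      ≡ t * (s * s * (s * s) * paths w x y + s * s * (s * s) * paths w x y)
    first-order = trans
      (∑-cong λ a → trans (∑-cong λ b → *-assoc t (edge x y a b) (paths (scale s w) a b))
        (sym (*-∑ t (λ b → edge x y a b * paths (scale s w) a b))))
      (trans (sym (*-∑ t (λ a → ∑ λ b → edge x y a b * paths (scale s w) a b)))
        (cong (t *_) (trans (∑-edge x y (paths (scale s w)))
          (cong₂ _+_ (paths-scale s w x y)
            (trans (paths-scale s w y x) (cong (s * s * (s * s) *_) (paths-sym W y x)))))))
    eq : ∀ c p s t → ½ * (s * (s * s * (s * s)) * c
        + + 5 / 1 * (t * (s * s * (s * s) * p + s * s * (s * s) * p)))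
      ≡ s * (s * s * (s * s)) * (½ * c) + + 5 / 1 * t * (s * s * (s * s)) * p
    eq = solve-∀ ℚ-ring

β≤1/27 : ∀ {w : Fin n → Fin n → ℚ} → IsUnitWeight w → β w ≤ + 1 / 27
β≤1/27 {w = w} U = β≤M/54 U {1ℚ + 1ℚ} (0≤const (1ℚ + 1ℚ)) (λ i j →
  subst (w i j ≤_) (total≡2 U)
    (≤-trans (term≤∑ (nonneg W i) j) (term≤∑ (λ i → 0≤∑ (nonneg W i)) i)))
  where
  W : IsWeight w
  W = isWeight U

β≤1 : ∀ {w : Fin n → Fin n → ℚ} → IsUnitWeight w → β w ≤ 1ℚ
β≤1 U = ≤-trans (β≤1/27 U) (≤ᵇ⇒≤ {+ 1 / 27} {1ℚ} _)

0≤β : ∀ {w : Fin n → Fin n → ℚ} → IsUnitWeight w → 0ℚ ≤ β w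
0≤β U = 0≤* (0≤const ½)
  (0≤∑ λ a → 0≤∑ λ b → 0≤∑ λ c → 0≤∑ λ d → 0≤∑ λ e → 0≤cycle (isWeight U) a b c d e)

-- For t = ε/40 the linear gain 5tε is 200t². It outweighs the quadratic loss, which is about 10t²β
-- with β ≤ 1, as well as the promised increase ε²/100 = 16t².
improve : ∀ {w : Fin n → Fin n → ℚ} → IsUnitWeight w → ∀ {x y} → x ≢ y → ∀ {ε} → 0ℚ ≤ ε → ε ≤ 1ℚ →
  β w + ε ≤ paths w x y → ∃[ w′ ] (IsUnitWeight {n} w′ × β w + + 1 / 100 * (ε * ε) ≤ β w′)
improve {w = w} U {x} {y} x≢y {ε} 0≤ε ε≤1 β+ε≤paths =
  shift t x y w , shift-isUnitWeight U x≢y 0≤t t≤1 , ≤-trans gain (shift-gain U x≢y 0≤t t≤1)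
  where
  t s : ℚ
  t = + 1 / 40 * ε
  s = 1ℚ - t
  0≤t : 0ℚ ≤ t
  0≤t = 0≤* (0≤const (+ 1 / 40)) 0≤ε
  t≤1/40 : t ≤ + 1 / 40
  t≤1/40 = *-monoˡ-≤ (0≤const (+ 1 / 40)) ε≤1
  t≤1 : t ≤ 1ℚ
  t≤1 = ≤-trans t≤1/40 (≤ᵇ⇒≤ {+ 1 / 40} {1ℚ} _)
  0≤s : 0ℚ ≤ s
  0≤s = p≤q⇒0≤q-p t≤1
  0≤1/40-t : 0ℚ ≤ + 1 / 40 - t
  0≤1/40-t = p≤q⇒0≤q-p t≤1/40
  gain : β w + + 1 / 100 * (ε * ε)
    ≤ s * (s * s * (s * s)) * β w + + 5 / 1 * t * (s * s * (s * s)) * paths w x y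
  gain = by-gap
    (0≤+ (0≤+ (0≤+
      (0≤* (0≤* (0≤* (0≤const (+ 5 / 1)) 0≤t) (0≤* (0≤square s) (0≤square s))) (p≤q⇒0≤q-p β+ε≤paths))
      (0≤* (0≤* (0≤* 0≤t 0≤t)
                (0≤+ (0≤+ (0≤const (+ 59 / 10)) (0≤* (0≤const (+ 4 / 1)) 0≤1/40-t)) (0≤square t)))
           (0≤+ (0≤* (0≤+ (0≤const 1ℚ) (0≤* (0≤const (+ 4 / 1)) 0≤t)) (0≤β U))
                (0≤* (0≤const (+ 5 / 1)) (0≤* 0≤t 0≤ε)))))
      (0≤* (0≤* 0≤t 0≤t) (0≤* (0≤const (+ 16 / 1)) (p≤q⇒0≤q-p (β≤1 U)))))
      (0≤* (0≤* 0≤t 0≤t) (0≤+ (0≤const (+ 148 / 1)) (0≤* (0≤const (+ 800 / 1)) 0≤1/40-t))))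
    (eq (β w) (paths w x y) ε)
    where
    eq : ∀ b p ε → let t = + 1 / 40 * ε; s = 1ℚ - t; q = s * s * (s * s) in
      s * q * b + + 5 / 1 * t * q * p - (b + + 1 / 100 * (ε * ε))
      ≡ + 5 / 1 * t * q * (p - (b + ε))
        + t * t * (+ 59 / 10 + + 4 / 1 * (+ 1 / 40 - t) + t * t)
          * ((1ℚ + + 4 / 1 * t) * b + + 5 / 1 * (t * ε))
        + t * t * (+ 16 / 1 * (1ℚ - b))
        + t * t * (+ 148 / 1 + + 800 / 1 * (+ 1 / 40 - t))
    eq = solve-∀ ℚ-ring

-- Repeated improvement

suc/1 : ∀ k → + suc k / 1 ≡ 1ℚ + + k / 1
suc/1 k = toℚᵘ-injective (ℚᵘₚ.≃-trans (toℚᵘ-fromℚᵘ (mkℚᵘ (+ suc k) 0))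
  (ℚᵘₚ.≃-trans (*≡* (cong (λ z → (+ 1 ℤ.+ z) ℤ.* + 1) (sym (ℤₚ.*-identityʳ (+ k)))))
  (ℚᵘₚ.≃-sym (ℚᵘₚ.≃-trans (toℚᵘ-homo-+ 1ℚ (+ k / 1))
    (ℚᵘₚ.+-congʳ (toℚᵘ 1ℚ) (toℚᵘ-fromℚᵘ (mkℚᵘ (+ k) 0)))))))

-- The denominator of c serves as k: multiplying by it leaves the numerator, a positive integer.
archimedean : ∀ {c} → 0ℚ < c → ∃[ k ] (1ℚ ≤ + k / 1 * c)
archimedean {c@(mkℚ (+ suc a) d _)} _ = suc d , toℚᵘ-cancel-≤ (ℚᵘₚ.≤-trans
  {j = mkℚᵘ (+ suc d) 0 ℚᵘ.* toℚᵘ c}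
  (*≤* (ℤ.+≤+ (ℕ.s≤s d≤)))
  (ℚᵘₚ.≤-reflexive (ℚᵘₚ.≃-sym (ℚᵘₚ.≃-trans (toℚᵘ-homo-* (+ suc d / 1) c)
    (ℚᵘₚ.*-congʳ (toℚᵘ-fromℚᵘ (mkℚᵘ (+ suc d) 0)))))))
  where
  d≤ : d ℕ.+ 0 ℕ.+ 0 ℕ.≤ (a ℕ.+ d ℕ.* suc a) ℕ.* 1
  d≤ = subst₂ ℕ._≤_ (sym (trans (ℕₚ.+-identityʳ (d ℕ.+ 0)) (ℕₚ.+-identityʳ d)))
    (sym (ℕₚ.*-identityʳ (a ℕ.+ d ℕ.* suc a)))
    (ℕₚ.≤-trans (ℕₚ.m≤m*n d (suc a)) (ℕₚ.m≤n+m (d ℕ.* suc a) a))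
archimedean {mkℚ (+ zero) d _} (*<* (ℤ.+<+ ()))
archimedean {mkℚ ℤ.-[1+ a ] d _} (*<* ())

search : (f : Fin n → Fin n → ℚ) (q : ℚ) →
  (∃[ x ] ∃[ y ] (x ≢ y × q ≤ f x y)) ⊎ (∀ i j → i ≢ j → f i j ≤ q)
search f q with Finₚ.any? (λ x → Finₚ.any? (λ y → ¬? (x ≟ y) ×-dec (q ≤? f x y)))
... | yes found = inj₁ found
... | no  none  = inj₂ λ i j i≢j → <⇒≤ (≰⇒> λ q≤f → none (i , j , i≢j , q≤f))

module _ {w₀ : Fin n → Fin n → ℚ} (U₀ : IsUnitWeight w₀) (1/625<β₀ : + 1 / 625 < β w₀) where

  private
    η ε c : ℚ
    η = β w₀ - + 1 / 625
    -- Thus 625ε = η/5, below 1/100 because β ≤ 1/27, and 1900ε = 76η/125 < η, so the critical bound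
    -- contradicts the excess η. Since ε depends on `w₀` only, every step of the climb gains the
    -- same `c`.
    ε = + 1 / 625 * (+ 1 / 5 * η)
    c = + 1 / 100 * (ε * ε)

    0<η : 0ℚ < η
    0<η = +-monoˡ-< (- (+ 1 / 625)) 1/625<β₀
    0<ε : 0ℚ < ε
    0<ε = 0<* (positive⁻¹ (+ 1 / 625)) (0<* (positive⁻¹ (+ 1 / 5)) 0<η)
    0<c : 0ℚ < c
    0<c = 0<* (positive⁻¹ (+ 1 / 100)) (0<* 0<ε 0<ε)
    625ε≤1/100 : + 625 / 1 * ε ≤ + 1 / 100
    625ε≤1/100 = by-gap
      (0≤+ (0≤* (0≤const (+ 1 / 5)) (p≤q⇒0≤q-p (β≤1/27 U₀))) (0≤const gap))
      (eq (β w₀))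
      where
      gap : ℚ
      gap = + 1 / 100 + + 1 / 5 * (+ 1 / 625 - + 1 / 27)
      eq : ∀ b → + 1 / 100 - + 625 / 1 * (+ 1 / 625 * (+ 1 / 5 * (b - + 1 / 625)))
        ≡ + 1 / 5 * (+ 1 / 27 - b) + (+ 1 / 100 + + 1 / 5 * (+ 1 / 625 - + 1 / 27))
      eq = solve-∀ ℚ-ring
    ε≤1 : ε ≤ 1ℚ
    ε≤1 = ≤-trans (by-gap (0≤* (0≤const (+ 624 / 1)) (<⇒≤ 0<ε)) (eq ε))
      (≤-trans 625ε≤1/100 (≤ᵇ⇒≤ {+ 1 / 100} {1ℚ} _))
      where
      eq : ∀ ε → + 625 / 1 * ε - ε ≡ + 624 / 1 * ε
      eq = solve-∀ ℚ-ring

    critical-impossible : + 1 / 625 + + 1900 / 1 * ε < β w₀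
    critical-impossible = subst₂ _<_ (+-identityʳ (+ 1 / 625 + + 1900 / 1 * ε)) (eq (β w₀))
      (+-monoʳ-< (+ 1 / 625 + + 1900 / 1 * ε) (0<* (positive⁻¹ (+ 49 / 125)) 0<η))
      where
      eq : ∀ b → + 1 / 625 + + 1900 / 1 * (+ 1 / 625 * (+ 1 / 5 * (b - + 1 / 625)))
        + + 49 / 125 * (b - + 1 / 625) ≡ b
      eq = solve-∀ ℚ-ring

    -- Either some edge has P(e) ≥ β + ε and receives mass, or the weight is approximately critical,
    -- which its value of β rules out.
    climb-step : ∀ {w} → IsUnitWeight w → β w₀ ≤ β w →
      ∃[ w′ ] (IsUnitWeight {n} w′ × β w + c ≤ β w′)
    climb-step {w} U β₀≤β = [ (λ (x , y , x≢y , β+ε≤paths) → improve U x≢y (<⇒≤ 0<ε) ε≤1 β+ε≤paths)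
                            , (λ paths≤ → ⊥-elim (not-critical paths≤)) ]′ (search (paths w) (β w + ε))
      where
      not-critical : (∀ i j → i ≢ j → paths w i j ≤ β w + ε) → ⊥
      not-critical paths≤ = <-irrefl refl (<-≤-trans critical-impossible (≤-trans β₀≤β
        (Critical.critical-bound U (<⇒≤ 0<ε) 625ε≤1/100 (≤-trans (<⇒≤ 1/625<β₀) β₀≤β) paths≤)))

    climb : ∀ k → ∃[ w ] (IsUnitWeight {n} w × β w₀ + + k / 1 * c ≤ β w)
    climb zero = w₀ , U₀ , ≤-reflexive (trans (cong (λ q → β w₀ + q) (*-zeroˡ c)) (+-identityʳ (β w₀)))
    climb (suc k) =
      let w  , U  , β₀+kc≤β = climb k
          w′ , U′ , β+c≤β′  = climb-step U (≤-trans (p≤p+q (β w₀) (0≤kc k)) β₀+kc≤β)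
      in  w′ , U′ , ≤-trans (≤-trans (≤-reflexive (split k)) (+-monoˡ-≤ c β₀+kc≤β)) β+c≤β′
      where
      0≤kc : ∀ k → 0ℚ ≤ + k / 1 * c
      0≤kc k = 0≤* (0≤const (+ k / 1) {{normalize-nonNeg k 1}}) (<⇒≤ 0<c)
      eq : ∀ b q c → b + (1ℚ + q) * c ≡ b + q * c + c
      eq = solve-∀ ℚ-ring
      split : ∀ k → β w₀ + + suc k / 1 * c ≡ β w₀ + + k / 1 * c + c
      split k = trans (cong (λ q → β w₀ + q * c) (suc/1 k)) (eq (β w₀) (+ k / 1) c)

  -- Enough steps raise β by at least 1 from a positive start, against β ≤ 1.
  excess-impossible : ⊥
  excess-impossible =
    let k , 1≤kc        = archimedean 0<c
        w , U , β₀+kc≤β = climb k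
    in  <-irrefl refl (<-≤-trans
          (+-mono-<-≤ (<-trans (positive⁻¹ (+ 1 / 625)) 1/625<β₀) 1≤kc) (≤-trans β₀+kc≤β (β≤1 U)))

β≤1/625 : ∀ {w : Fin n → Fin n → ℚ} → IsUnitWeight w → β w ≤ + 1 / 625
β≤1/625 U = ≮⇒≥ (excess-impossible U)

-- Comparison with b5

∧-true : ∀ {p q} → p ∧ q ≡ true → p ≡ true × q ≡ true
∧-true {true} {true} refl = refl , refl

⌊⌋-true : ∀ {P : Set} {d : Dec P} → ⌊ d ⌋ ≡ true → P
⌊⌋-true {d = yes p} _ = p

not⌊⌋-true : ∀ {P : Set} {d : Dec P} → not ⌊ d ⌋ ≡ true → ¬ P
not⌊⌋-true {d = no ¬p} _ = ¬p

-- The part of canonicity that selects one of the five rotations; the comparison b < e then selects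
-- one of the two orientations.
leastFirst : Fin n → Fin n → Fin n → Fin n → Fin n → Bool
leastFirst a b c d e = ⌊ a <? b ⌋ ∧ ⌊ a <? c ⌋ ∧ ⌊ a <? d ⌋ ∧ ⌊ a <? e ⌋

record LeastFirst (a b c d e : Fin n) : Set where
  constructor least
  field
    a<b : a Fin.< b
    a<c : a Fin.< c
    a<d : a Fin.< d
    a<e : a Fin.< e

leastFirst⁻ : ∀ {a b c d e : Fin n} → leastFirst a b c d e ≡ true → LeastFirst a b c d e
leastFirst⁻ {a = a} {b} {c} {d} {e} p =
  let ab , p₁ = ∧-true {⌊ a <? b ⌋} p
      ac , p₂ = ∧-true {⌊ a <? c ⌋} p₁
      ad , ae = ∧-true {⌊ a <? d ⌋} p₂
  in least (⌊⌋-true ab) (⌊⌋-true ac) (⌊⌋-true ad) (⌊⌋-true ae)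

⌊⌋-true⁺ : ∀ {P : Set} (d : Dec P) → P → ⌊ d ⌋ ≡ true
⌊⌋-true⁺ (yes _) _ = refl
⌊⌋-true⁺ (no ¬p) p = ⊥-elim (¬p p)

leastFirst⁺ : ∀ {a b c d e : Fin n} → LeastFirst a b c d e → leastFirst a b c d e ≡ true
leastFirst⁺ {a = a} {b} {c} {d} {e} (least a<b a<c a<d a<e) =
  cong₂ _∧_ (⌊⌋-true⁺ (a <? b) a<b) (cong₂ _∧_ (⌊⌋-true⁺ (a <? c) a<c)
    (cong₂ _∧_ (⌊⌋-true⁺ (a <? d) a<d) (⌊⌋-true⁺ (a <? e) a<e)))

record Canonical (a b c d e : Fin n) : Set where
  field
    isLeast : LeastFirst a b c d e
    b<e : b Fin.< e
    b≢c : b ≢ c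
    b≢d : b ≢ d
    c≢d : c ≢ d
    c≢e : c ≢ e
    d≢e : d ≢ e

canonical⁻ : ∀ {a b c d e : Fin n} → isCanonical5 a b c d e ≡ true → Canonical a b c d e
canonical⁻ {a = a} {b} {c} {d} {e} p =
  let ab , p₁ = ∧-true {⌊ a <? b ⌋} p
      ac , p₂ = ∧-true {⌊ a <? c ⌋} p₁
      ad , p₃ = ∧-true {⌊ a <? d ⌋} p₂
      ae , p₄ = ∧-true {⌊ a <? e ⌋} p₃
      be , p₅ = ∧-true {⌊ b <? e ⌋} p₄
      bc , p₆ = ∧-true {not ⌊ b ≟ c ⌋} p₅
      bd , p₇ = ∧-true {not ⌊ b ≟ d ⌋} p₆
      cd , p₈ = ∧-true {not ⌊ c ≟ d ⌋} p₇
      ce , de = ∧-true {not ⌊ c ≟ e ⌋} p₈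
  in record
    { isLeast = least (⌊⌋-true ab) (⌊⌋-true ac) (⌊⌋-true ad) (⌊⌋-true ae)
    ; b<e = ⌊⌋-true be ; b≢c = not⌊⌋-true bc ; b≢d = not⌊⌋-true bd
    ; c≢d = not⌊⌋-true cd ; c≢e = not⌊⌋-true ce ; d≢e = not⌊⌋-true de
    }

⟦⟧-+-≤ : ∀ p q r → (p ≡ true → r ≡ true) → (q ≡ true → r ≡ true) →
  (p ≡ true → q ≡ true → ⊥) → ⟦ p ⟧ + ⟦ q ⟧ ≤ ⟦ r ⟧
⟦⟧-+-≤ true  true  r p⇒r q⇒r excl = ⊥-elim (excl refl refl)
⟦⟧-+-≤ true  false r p⇒r q⇒r excl rewrite p⇒r refl = ≤-refl
⟦⟧-+-≤ false true  r p⇒r q⇒r excl rewrite q⇒r refl = ≤-refl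
⟦⟧-+-≤ false false r p⇒r q⇒r excl = 0≤⟦⟧ r

module _ {μ : Fin n → Fin n → ℚ} (μ-mass : IsProbMass n μ) where

  private
    module μ = IsProbMass μ-mass

    -- The diagonal of `μ` is not controlled by `total`, so it is masked out.
    w : Fin n → Fin n → ℚ
    w i j = N i j * μ i j

    W : IsWeight w
    W = record
      { symmetric = λ i j → cong₂ _*_ (N-sym i j) (μ.symmetric i j)
      ; nonneg    = λ i j → 0≤* (0≤N i j) (μ.nonneg i j)
      ; loopless  = λ i → trans (cong (_* μ i i) (N-refl i)) (*-zeroˡ (μ i i))
      }

    w≡μ : ∀ {i j} → i ≢ j → w i j ≡ μ i j
    w≡μ {i} {j} i≢j = trans (cong (_* μ i j) (N-≢ i≢j)) (*-identityˡ (μ i j))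

    upper : Fin n → Fin n → ℚ
    upper i j = if ⌊ i <? j ⌋ then μ i j else 0ℚ

    upper-< : ∀ {i j} → i Fin.< j → upper i j ≡ μ i j
    upper-< {i} {j} i<j = cong (if_then μ i j else 0ℚ) (⌊⌋-true⁺ (i <? j) i<j)

    upper-≮ : ∀ {i j} → ¬ i Fin.< j → upper i j ≡ 0ℚ
    upper-≮ {i} {j} i≮j with i <? j
    ... | yes i<j = ⊥-elim (i≮j i<j)
    ... | no  _   = refl

    w≡upper+upper : ∀ i j → w i j ≡ upper i j + upper j i
    w≡upper+upper i j with Finₚ.<-cmp i j
    ... | tri< i<j i≢j j≮i = trans (w≡μ i≢j)
      (sym (trans (cong₂ _+_ (upper-< i<j) (upper-≮ j≮i)) (+-identityʳ (μ i j))))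
    ... | tri≈ i≮j refl _ = trans (loopless W i) (sym (cong₂ _+_ (upper-≮ i≮j) (upper-≮ i≮j)))
    ... | tri> i≮j i≢j j<i = trans (w≡μ i≢j) (sym (trans (cong₂ _+_ (upper-≮ i≮j) (upper-< j<i))
      (trans (+-identityˡ (μ j i)) (μ.symmetric j i))))

    U : IsUnitWeight w
    U = record
      { isWeight = W
      ; total≡2 = trans
          (∑-cong λ i → trans (∑-cong (w≡upper+upper i)) (∑-+ (upper i) (λ j → upper j i)))
          (trans (∑-+ (λ i → ∑ (upper i)) (λ i → ∑ λ j → upper j i))
                 (cong₂ _+_ μ.total (trans (∑-swap (λ i j → upper j i)) μ.total)))
      }

    canonicalTerm : Fin n → Fin n → Fin n → Fin n → Fin n → ℚ
    canonicalTerm a b c d e =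
      if isCanonical5 a b c d e then μ a b * μ b c * μ c d * μ d e * μ e a else 0ℚ

    canonical-cycle : ∀ {a b c d e} → Canonical a b c d e →
      μ a b * μ b c * μ c d * μ d e * μ e a ≡ cycle w a b c d e
    canonical-cycle {a} {b} {c} {d} {e} can = trans
      (eq (μ a b) (μ b c) (μ c d) (μ d e) (μ e a))
      (sym (cong₂ _*_ (w≡μ (Finₚ.<⇒≢ a<b))
        (cong₂ _*_
          (cong₂ _*_ (cong₂ _*_ (cong₂ _*_ (w≡μ b≢c) (w≡μ c≢d)) (w≡μ d≢e))
                     (w≡μ (≢-sym (Finₚ.<⇒≢ a<e))))
          (cong₂ _*_ (cong₂ _*_ (cong₂ _*_ (cong₂ _*_ (N-≢ (Finₚ.<⇒≢ a<c)) (N-≢ b≢d)) (N-≢ c≢e))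
                                (N-≢ (≢-sym (Finₚ.<⇒≢ a<d)))) (N-≢ (≢-sym (Finₚ.<⇒≢ b<e)))))))
      where
      open Canonical can
      open LeastFirst isLeast
      eq : ∀ p q r s t → p * q * r * s * t ≡ p * (q * r * s * t * (1ℚ * 1ℚ * 1ℚ * 1ℚ * 1ℚ))
      eq = solve-∀ ℚ-ring

    canonicalTerm≡ : ∀ a b c d e →
      canonicalTerm a b c d e ≡ ⟦ isCanonical5 a b c d e ⟧ * cycle w a b c d e
    canonicalTerm≡ a b c d e = by-cases (isCanonical5 a b c d e) (λ p → canonical-cycle (canonical⁻ p))
      where
      by-cases : ∀ {p q} x → (x ≡ true → p ≡ q) → (if x then p else 0ℚ) ≡ ⟦ x ⟧ * q
      by-cases {q = q} true  p≡q = trans (p≡q refl) (sym (*-identityˡ q))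
      by-cases {q = q} false _   = sym (*-zeroˡ q)

    -- A tuple and its reflection have equal cycle weight and are never both canonical, since one
    -- needs b < e and the other e < b.
    two-orientations : ∀ a b c d e → canonicalTerm a b c d e + canonicalTerm a e d c b
      ≤ ⟦ leastFirst a b c d e ⟧ * cycle w a b c d e
    two-orientations a b c d e = ≤-trans
      (≤-reflexive (trans
        (cong₂ _+_ (canonicalTerm≡ a b c d e)
          (trans (canonicalTerm≡ a e d c b)
            (cong (⟦ isCanonical5 a e d c b ⟧ *_) (sym (cycle-reflect W a b c d e)))))
        (sym (*-distribʳ-+ (cycle w a b c d e) ⟦ isCanonical5 a b c d e ⟧ ⟦ isCanonical5 a e d c b ⟧))))
      (*-monoʳ-≤-nonNeg (cycle w a b c d e) {{nonNegative (0≤cycle W a b c d e)}}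
        (⟦⟧-+-≤ (isCanonical5 a b c d e) (isCanonical5 a e d c b) (leastFirst a b c d e)
          (λ p → leastFirst⁺ (Canonical.isLeast (canonical⁻ {b = b} {c} {d} {e} p)))
          (λ q → let open LeastFirst (Canonical.isLeast (canonical⁻ {b = e} {d} {c} {b} q)) in
            leastFirst⁺ (least a<e a<d a<c a<b))
          (λ p q → Finₚ.<-asym (Canonical.b<e (canonical⁻ {b = b} {c} {d} {e} p))
                               (Canonical.b<e (canonical⁻ {b = e} {d} {c} {b} q)))))

    -- The factor 2 comes from the orientations and the factor 5 from the rotations: two entries of
    -- a tuple cannot each be strictly less than the other.
    10b5≤cycles : + 5 / 1 * (b5 n μ + b5 n μ) ≤ cycles w
    10b5≤cycles = ≤-trans
      (*-monoˡ-≤ (0≤const (+ 5 / 1)) (≤-trans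
        (≤-reflexive (trans (cong (λ s → b5 n μ + s) (sym (∑₅-reflect canonicalTerm)))
          (sym (∑₅-+ canonicalTerm (λ a b c d e → canonicalTerm a e d c b)))))
        (∑₅-mono two-orientations)))
      (rotation-bound W leastFirst
        (λ a b c d e p q → ⊥-elim (Finₚ.<-asym (LeastFirst.a<b (leastFirst⁻ {b = b} {c} {d} {e} p))
                                             (LeastFirst.a<e (leastFirst⁻ {b = c} {d} {e} {a} q))))
        (λ a b c d e p q → ⊥-elim (Finₚ.<-asym (LeastFirst.a<c (leastFirst⁻ {b = b} {c} {d} {e} p))
                                             (LeastFirst.a<d (leastFirst⁻ {b = d} {e} {a} {b} q)))))

  b5≤1/3125 : b5 n μ ≤ + 1 / 3125
  b5≤1/3125 = *-cancel (positive⁻¹ (+ 5 / 1)) (≤-trans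
    (subst (_≤ β w) (eq (b5 n μ)) (*-monoˡ-≤ (0≤const ½) 10b5≤cycles)) (β≤1/625 U))
    where
    eq : ∀ b → ½ * (+ 5 / 1 * (b + b)) ≡ + 5 / 1 * b
    eq = solve-∀ ℚ-ring

-- The extremal pentagon

pentagon : Fin 5 → Fin 5 → ℚ
pentagon i j = if next i j ∨ next j i then + 1 / 5 else 0ℚ
  where
  next : Fin 5 → Fin 5 → Bool
  next i j = does (suc (toℕ i) ℕ.% 5 ℕ.≟ toℕ j)

pentagon-mass : IsProbMass 5 pentagon
pentagon-mass = record
  { symmetric = from-yes (Finₚ.all? λ i → Finₚ.all? λ j → pentagon i j ℚ.≟ pentagon j i)
  ; nonneg    = from-yes (Finₚ.all? λ i → Finₚ.all? λ j → 0ℚ ≤? pentagon i j)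
  ; total     = refl
  }

-- By evaluation: (0,1,2,3,4) is the only canonical tuple whose five sides all have positive mass.
b5-pentagon : b5 5 pentagon ≡ + 1 / 3125
b5-pentagon = refl

theorem3p4 : ((n : ℕ) (μ : Fin n → Fin n → ℚ) → IsProbMass n μ → b5 n μ ≤ + 1 / 3125)
    × ((ε : ℚ) → 0ℚ < ε →
    ∃[ n ] ∃[ μ ] (IsProbMass n μ × (+ 1 / 3125 - ε < b5 n μ)))
-- The supremum is attained, so one witness serves every ε.
theorem3p4 = (λ n μ → b5≤1/3125) , λ ε 0<ε → 5 , pentagon , pentagon-mass ,
  subst₂ _<_ refl (trans (+-identityʳ (+ 1 / 3125)) (sym b5-pentagon))
    (+-monoʳ-< (+ 1 / 3125) (neg-antimono-< 0<ε))
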